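{- For any integers $k\ge 2$ and $t\ge 2$, $$\operatorname{ex}(n,E^+_{k,t})=O\left(n^{\frac{3k-1}{2k-1}}\right)\quad\text{as } n\to\infty,$$ where the implied constant may depend on $k$ and $t$.
   Context: All graphs are finite and simple. The extremal number $\operatorname{ex}(n,H)$ is the maximum number of edges in an $n$-vertex graph containing no (not necessarily induced) subgraph isomorphic to $H$. For $k,t\ge 2$, the theta graph $\theta_{k,t}$ consists of two vertices joined by $t$ internally vertex-disjoint paths of length $k$ (that is, with $k$ edges); it is a connected bipartite graph, with bipartition $A\cup B$. The graph $E_{k,t}$ is obtained from $\theta_{k,t}$ by adding two new vertices $x,y$, joining $x$ to every vertex of $A$ and $y$ to every vertex of $B$. The graph $E^+_{k,t}$ is obtained from $E_{k,t}$ by adding the edge $xy$. -}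

module Defs where

open import Data.Empty using (⊥)
open import Data.Fin using (Fin; zero; suc; toℕ; finToFun; funToFin)
import Data.Fin as Fin
import Data.Fin.Properties as Fin
open import Data.List using (List; length; filter; allFin; cartesianProduct)
open import Data.List.Properties using (length-filter; filter-≐; filter-none)
import Data.List.Relation.Unary.All as All
open import Data.Nat using (ℕ; zero; suc; parity; _+_; _*_; _∸_; _^_; _≤_; _<_; z≤n; s≤s)
import Data.Nat as ℕ
import Data.Nat.Properties as ℕ
open import Data.Parity.Base using (Parity; 0ℙ; 1ℙ; _⁻¹)
import Data.Parity.Properties as ℙ
open import Data.Product using (Σ; ∃; ∃₂; _×_; _,_; proj₁; proj₂)
open import Data.Sum using (_⊎_; inj₁; inj₂; swap)
open import Function using (_∘_; _↔_; mk↔ₛ′; Injective; Inverse)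
open import Level using (0ℓ)
open import Relation.Binary using (Rel; Decidable; DecidableEquality; Symmetric; Irreflexive)
open import Relation.Binary.PropositionalEquality
  using (_≡_; _≢_; refl; sym; trans; cong; subst; subst₂; _≗_)
open import Relation.Nullary using (Dec; yes; no; ¬_; ¬?; contradiction)
open import Relation.Nullary.Decidable using (map′; _×-dec_; _⊎-dec_; _→-dec_)
open import Relation.Unary using (Pred)
import Relation.Unary as U

private
  variable
    V W : Set

record Graph (V : Set) : Set₁ where
  infix 4 _~_ _~?_
  field
    _~_      : Rel V 0ℓ
    _~?_     : Decidable _~_
    ~-sym    : Symmetric _~_
    ~-irrefl : Irreflexive _≡_ _~_

open Graph

record Finite (V : Set) : Set where
  field
    order       : ℕ
    enumeration : V ↔ Fin order

record HasEdge (G : Graph V) : Set where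
  constructor edge
  field
    {source′ target′} : V
    adjacent          : _~_ G source′ target′

-- Each edge is counted once, as the pair (i , j) of its endpoints with i < j.
edgeCount : ∀ {n} → Graph (Fin n) → ℕ
edgeCount {n} G =
  length (filter (λ (i , j) → (i Fin.<? j) ×-dec (_~?_ G i j))
                 (cartesianProduct (allFin n) (allFin n)))

IsEmbedding : Graph W → Graph V → (W → V) → Set
IsEmbedding H G f =
  Injective _≡_ _≡_ f × (∀ {u v} → _~_ H u v → _~_ G (f u) (f v))

-- G has a (not necessarily induced) subgraph isomorphic to H.
_⊑_ : Graph W → Graph V → Set
H ⊑ G = ∃ (IsEmbedding H G)

record IsExtremalNumber (n : ℕ) (H : Graph W) (m : ℕ) : Set₁ where
  field
    attained : Σ (Graph (Fin n)) λ G → ¬ (H ⊑ G) × edgeCount G ≡ m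
    maximal  : ∀ (G : Graph (Fin n)) → ¬ (H ⊑ G) → edgeCount G ≤ m

------------------------------------------------------------------------
-- Existence of the extremal number, by exhaustive search.

private
  any→? : ∀ {m n ℓ} {P : Pred (Fin m → Fin n) ℓ} →
          (∀ {f g} → f ≗ g → P f → P g) → U.Decidable P → Dec (∃ P)
  any→? resp P? =
    map′ (λ (i , p) → finToFun i , p)
         (λ (f , p) → funToFin f , resp (sym ∘ Fin.finToFun-funToFin f) p)
         (Fin.any? (P? ∘ finToFun))

  module _ {W V : Set} (finW : Finite W) (H : Graph W) where
    open Finite finW
    open Inverse enumeration

    private
      from-injective : ∀ {i j} → from i ≡ from j → i ≡ j
      from-injective {i} {j} eq =
        trans (sym (strictlyInverseˡ i)) (trans (cong to eq) (strictlyInverseˡ j))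

      to-injective : ∀ {u v} → to u ≡ to v → u ≡ v
      to-injective {u} {v} eq =
        trans (sym (strictlyInverseʳ u)) (trans (cong from eq) (strictlyInverseʳ v))

    ⊑-dec : ∀ {n} (G : Graph (Fin n)) → Dec (H ⊑ G)
    ⊑-dec {n} G = map′ forth back (any→? resp Q?)
      where
      Q : (Fin order → Fin n) → Set
      Q f = (∀ i j → f i ≡ f j → i ≡ j) ×
            (∀ i j → _~_ H (from i) (from j) → _~_ G (f i) (f j))

      Q? : U.Decidable Q
      Q? f = (Fin.all? λ i → Fin.all? λ j → (f i Fin.≟ f j) →-dec (i Fin.≟ j)) ×-dec
             (Fin.all? λ i → Fin.all? λ j →
                _~?_ H (from i) (from j) →-dec _~?_ G (f i) (f j))

      resp : ∀ {f g} → f ≗ g → Q f → Q g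
      resp f≗g (inj , hom) =
        (λ i j eq → inj i j (trans (f≗g i) (trans eq (sym (f≗g j))))) ,
        (λ i j e → subst₂ (_~_ G) (f≗g i) (f≗g j) (hom i j e))

      forth : ∃ Q → H ⊑ G
      forth (f , inj , hom) = f ∘ to ,
        (λ eq → to-injective (inj _ _ eq)) ,
        (λ {u} {v} e → hom _ _
          (subst₂ (_~_ H) (sym (strictlyInverseʳ u)) (sym (strictlyInverseʳ v)) e))

      back : H ⊑ G → ∃ Q
      back (f , inj , hom) = f ∘ from ,
        (λ i j eq → from-injective (inj eq)) ,
        (λ i j e → hom e)

  _≈_ : Graph V → Graph V → Set
  G ≈ G′ = ∀ i j → (_~_ G i j → _~_ G′ i j) × (_~_ G′ i j → _~_ G i j)

  ⊑-resp-≈ : {H : Graph W} {G G′ : Graph V} → G ≈ G′ → H ⊑ G → H ⊑ G′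
  ⊑-resp-≈ eq (f , inj , hom) = f , inj , λ e → proj₁ (eq _ _) (hom e)

  ≈-sym : {G G′ : Graph V} → G ≈ G′ → G′ ≈ G
  ≈-sym eq i j = proj₂ (eq i j) , proj₁ (eq i j)

  edgeCount-resp-≈ : ∀ {n} {G G′ : Graph (Fin n)} → G ≈ G′ → edgeCount G ≡ edgeCount G′
  edgeCount-resp-≈ {n} {G} {G′} eq = cong length
    (filter-≐ (λ (i , j) → (i Fin.<? j) ×-dec (_~?_ G i j))
              (λ (i , j) → (i Fin.<? j) ×-dec (_~?_ G′ i j))
      ((λ (l , e) → l , proj₁ (eq _ _) e) , (λ (l , e) → l , proj₂ (eq _ _) e))
      (cartesianProduct (allFin n) (allFin n)))

  -- The code c : Fin n → Fin (2 ^ n) is read as a 0-1 matrix, and i, j are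
  -- adjacent when i ≢ j and one of the entries (i , j), (j , i) is 1.
  decode : ∀ {n} → (Fin n → Fin (2 ^ n)) → Graph (Fin n)
  decode {n} c = record
    { _~_      = λ i j → i ≢ j × (One i j ⊎ One j i)
    ; _~?_     = λ i j → ¬? (i Fin.≟ j) ×-dec (one? i j ⊎-dec one? j i)
    ; ~-sym    = λ (i≢j , e) → i≢j ∘ sym , swap e
    ; ~-irrefl = λ i≡j (i≢j , _) → i≢j i≡j
    }
    where
    One : Fin n → Fin n → Set
    One i j = finToFun {2} {n} (c i) j ≡ suc zero
    one? : Decidable One
    one? i j = finToFun {2} {n} (c i) j Fin.≟ suc zero

  decode-cong : ∀ {n} {c d : Fin n → Fin (2 ^ n)} → c ≗ d → decode c ≈ decode d
  decode-cong {n} {c} {d} eq i j = go c d eq , go d c (sym ∘ eq)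
    where
    go : ∀ c d → c ≗ d → _~_ (decode c) i j → _~_ (decode d) i j
    go c d eq (ne , inj₁ e) =
      ne , inj₁ (trans (cong (λ z → finToFun {2} {n} z j) (sym (eq i))) e)
    go c d eq (ne , inj₂ e) =
      ne , inj₂ (trans (cong (λ z → finToFun {2} {n} z i) (sym (eq j))) e)

  bit : ∀ {P : Set} → Dec P → Fin 2
  bit (yes _) = suc zero
  bit (no  _) = zero

  bit⁺ : ∀ {P : Set} (d : Dec P) → P → bit d ≡ suc zero
  bit⁺ (yes _) p = refl
  bit⁺ (no ¬p) p = contradiction p ¬p

  bit⁻ : ∀ {P : Set} (d : Dec P) → bit d ≡ suc zero → P
  bit⁻ (yes p) _ = p

  encode : ∀ {n} → Graph (Fin n) → Fin n → Fin (2 ^ n)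
  encode G i = funToFin (λ j → bit (_~?_ G i j))

  decode-encode : ∀ {n} (G : Graph (Fin n)) → decode (encode G) ≈ G
  decode-encode G i j = f , g
    where
    entry : ∀ i j → finToFun (encode G i) j ≡ bit (_~?_ G i j)
    entry i = Fin.finToFun-funToFin (λ j → bit (_~?_ G i j))
    f : _~_ (decode (encode G)) i j → _~_ G i j
    f (_ , inj₁ e) = bit⁻ (_~?_ G i j) (trans (sym (entry i j)) e)
    f (_ , inj₂ e) = ~-sym G (bit⁻ (_~?_ G j i) (trans (sym (entry j i)) e))
    g : _~_ G i j → _~_ (decode (encode G)) i j
    g e = (λ i≡j → ~-irrefl G i≡j e) , inj₁ (trans (entry i j) (bit⁺ (_~?_ G i j) e))

  greatest : ∀ {ℓ} {P : Pred ℕ ℓ} → U.Decidable P → P 0 → ∀ b →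
             ∃ λ m → P m × (∀ {j} → j ≤ b → P j → j ≤ m)
  greatest P? p0 zero = 0 , p0 , λ j≤0 _ → j≤0
  greatest P? p0 (suc b) with P? (suc b)
  ... | yes p = suc b , p , λ j≤ _ → j≤
  ... | no ¬p with greatest P? p0 b
  ... | m , pm , max = m , pm , λ {j} j≤ pj → go j≤ pj (ℕ.m≤n⇒m<n∨m≡n j≤)
    where
    go : ∀ {j} → j ≤ suc b → _ → j < suc b ⊎ j ≡ suc b → j ≤ m
    go _ pj (inj₁ (s≤s j≤b)) = max j≤b pj
    go _ pj (inj₂ refl)      = contradiction pj ¬p

  emptyGraph : ∀ {V} → Graph V
  emptyGraph = record
    { _~_ = λ _ _ → ⊥ ; _~?_ = λ _ _ → no λ () ; ~-sym = λ () ; ~-irrefl = λ _ () }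

-- The hypothesis HasEdge H cannot be dropped: an edgeless H is contained in
-- every graph with sufficiently many vertices.
extremalNumber : ∀ n (H : Graph W) → Finite W → HasEdge H → ∃ (IsExtremalNumber n H)
extremalNumber n H fin (edge e) = m , record
  { attained = decode (proj₁ attained) , proj₂ attained
  ; maximal  = λ G free → max (length-filter _ pairs) (code G free)
  }
  where
  pairs : List (Fin n × Fin n)
  pairs = cartesianProduct (allFin n) (allFin n)

  R : ℕ → (Fin n → Fin (2 ^ n)) → Set
  R m c = ¬ (H ⊑ decode c) × edgeCount (decode c) ≡ m

  R-resp : ∀ {m c d} → c ≗ d → R m c → R m d
  R-resp {m} {c} {d} eq (free , count) =
    (free ∘ ⊑-resp-≈ {H = H} {decode d} {decode c} (≈-sym {G = decode c} {decode d} c≈d)) ,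
    trans (sym (edgeCount-resp-≈ {G = decode c} {decode d} c≈d)) count
    where c≈d = decode-cong eq

  R? : ∀ m → Dec (∃ (R m))
  R? m = any→? R-resp (λ c →
    ¬? (⊑-dec {V = Fin n} fin H (decode c)) ×-dec (edgeCount (decode c) ℕ.≟ m))

  code : ∀ G → ¬ (H ⊑ G) → ∃ (R (edgeCount G))
  code G free = encode G ,
    (free ∘ ⊑-resp-≈ {H = H} {decode (encode G)} {G} (decode-encode G)) ,
    edgeCount-resp-≈ {G = decode (encode G)} {G} (decode-encode G)

  empty-count : edgeCount (emptyGraph {Fin n}) ≡ 0
  empty-count = cong length (filter-none _ (All.universal (λ _ ()) pairs))

  R₀ : ∃ (R 0)
  R₀ = subst (λ m → ∃ (R m)) empty-count (code emptyGraph λ (_ , _ , hom) → hom e)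

  best = greatest R? R₀ (length pairs)
  m = proj₁ best
  attained = proj₁ (proj₂ best)
  max = proj₂ (proj₂ best)

opaque
  ex : ℕ → (H : Graph W) → ⦃ Finite W ⦄ → ⦃ HasEdge H ⦄ → ℕ
  ex n H ⦃ fin ⦄ ⦃ e ⦄ = proj₁ (extremalNumber n H fin e)

  ex-isExtremalNumber : ∀ n (H : Graph W) ⦃ _ : Finite W ⦄ ⦃ _ : HasEdge H ⦄ →
                        IsExtremalNumber n H (ex n H)
  ex-isExtremalNumber n H ⦃ fin ⦄ ⦃ e ⦄ = proj₂ (extremalNumber n H fin e)

------------------------------------------------------------------------
-- Theta graphs

-- inner i j is the vertex at distance j + 1 from source on the i-th path.
data ΘVertex (k t : ℕ) : Set where
  source : ΘVertex k t
  sink   : ΘVertex k t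
  inner  : (i : Fin t) (j : Fin (k ∸ 1)) → ΘVertex k t

-- The edges of the paths, directed from source to sink.
data Step (k t : ℕ) : Rel (ΘVertex k t) 0ℓ where
  first : ∀ {i j}    → toℕ j ≡ 0              → Step k t source (inner i j)
  next  : ∀ {i j j′} → toℕ j′ ≡ suc (toℕ j)   → Step k t (inner i j) (inner i j′)
  last  : ∀ {i j}    → suc (suc (toℕ j)) ≡ k  → Step k t (inner i j) sink

module _ {k t : ℕ} where

  position : ΘVertex k t → ℕ
  position source      = 0
  position sink        = k
  position (inner i j) = suc (toℕ j)

  step-position : ∀ {u v} → Step k t u v → position v ≡ suc (position u)
  step-position (first j≡0)  = cong suc j≡0
  step-position (next j′≡1+j) = cong suc j′≡1+j
  step-position (last 2+j≡k) = sym 2+j≡k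

  step? : Decidable (Step k t)
  step? source      source        = no λ ()
  step? source      sink          = no λ ()
  step? source      (inner i j)   = map′ first (λ { (first p) → p }) (toℕ j ℕ.≟ 0)
  step? sink        _             = no λ ()
  step? (inner i j) source        = no λ ()
  step? (inner i j) sink          = map′ last (λ { (last p) → p }) (suc (suc (toℕ j)) ℕ.≟ k)
  step? (inner i j) (inner i′ j′) =
    map′ (λ { (refl , p) → next p }) (λ { (next p) → refl , p })
         ((i Fin.≟ i′) ×-dec (toℕ j′ ℕ.≟ suc (toℕ j)))

  step-irrefl : ∀ {u} → ¬ Step k t u u
  step-irrefl s = ℕ.1+n≢n (sym (step-position s))

-- The intended range is k ≥ 2 (for k ≤ 1 there are no edges).
θ : ∀ k t → Graph (ΘVertex k t)
θ k t = record
  { _~_      = λ u v → Step k t u v ⊎ Step k t v u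
  ; _~?_     = λ u v → step? u v ⊎-dec step? v u
  ; ~-sym    = swap
  ; ~-irrefl = λ { refl (inj₁ s) → step-irrefl s ; refl (inj₂ s) → step-irrefl s }
  }

-- A and B are the fibres of side over 0ℙ and 1ℙ.
record Bipartition (G : Graph V) : Set where
  field
    side   : V → Parity
    proper : ∀ {u v} → _~_ G u v → side u ≢ side v

-- For k, t ≥ 2 the graph θ k t is connected, so this is its only bipartition up
-- to interchanging A and B, and interchanging them only swaps the roles of x and y.
θ-bipartition : ∀ k t → Bipartition (θ k t)
θ-bipartition k t = record
  { side   = parity ∘ position
  ; proper = λ { (inj₁ s) → step-proper s ; (inj₂ s) → step-proper s ∘ sym }
  }
  where
  step-proper : ∀ {u v} → Step k t u v → parity (position u) ≢ parity (position v)
  step-proper {u} s eq = ℙ.p≢p⁻¹ (parity (position u))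
    (trans eq (trans (cong parity (step-position s)) (sym flip)))
    where
    flip : (parity (position u)) ⁻¹ ≡ parity (suc (position u))
    flip = trans (cong _⁻¹ (sym (ℙ.suc-homo-⁻¹ (position u)))) (ℙ.⁻¹-involutive _)

------------------------------------------------------------------------
-- The graphs E k t and E⁺ k t

data WithApices (V : Set) : Set where
  old : V → WithApices V
  x y : WithApices V

-- x is joined to every vertex of A and y to every vertex of B.
addApices : (G : Graph V) → Bipartition G → Graph (WithApices V)
addApices {V} G P = record
  { _~_ = _∼_ ; _~?_ = _∼?_ ; ~-sym = λ {u} {v} → ∼-sym u v
  ; ~-irrefl = λ { {u} refl → ∼-irrefl u } }
  where
  open Bipartition P

  _∼_ : Rel (WithApices V) 0ℓ
  old u ∼ old v = _~_ G u v
  old u ∼ x     = side u ≡ 0ℙ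
  x     ∼ old v = side v ≡ 0ℙ
  old u ∼ y     = side u ≡ 1ℙ
  y     ∼ old v = side v ≡ 1ℙ
  x     ∼ x     = ⊥
  x     ∼ y     = ⊥
  y     ∼ x     = ⊥
  y     ∼ y     = ⊥

  _∼?_ : Decidable _∼_
  old u ∼? old v = _~?_ G u v
  old u ∼? x     = side u ℙ.≟ 0ℙ
  x     ∼? old v = side v ℙ.≟ 0ℙ
  old u ∼? y     = side u ℙ.≟ 1ℙ
  y     ∼? old v = side v ℙ.≟ 1ℙ
  x     ∼? x     = no λ ()
  x     ∼? y     = no λ ()
  y     ∼? x     = no λ ()
  y     ∼? y     = no λ ()

  ∼-sym : ∀ u v → u ∼ v → v ∼ u
  ∼-sym (old u) (old v) e = ~-sym G e
  ∼-sym (old u) x       e = e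
  ∼-sym x       (old v) e = e
  ∼-sym (old u) y       e = e
  ∼-sym y       (old v) e = e

  ∼-irrefl : ∀ u → ¬ (u ∼ u)
  ∼-irrefl (old u) e = ~-irrefl G refl e

addEdge : Graph V → DecidableEquality V → (a b : V) → a ≢ b → Graph V
addEdge G _≟_ a b a≢b = record
  { _~_      = λ u v → _~_ G u v ⊎ ((u ≡ a × v ≡ b) ⊎ (u ≡ b × v ≡ a))
  ; _~?_     = λ u v → _~?_ G u v ⊎-dec
                       (((u ≟ a) ×-dec (v ≟ b)) ⊎-dec ((u ≟ b) ×-dec (v ≟ a)))
  ; ~-sym    = λ { (inj₁ e)              → inj₁ (~-sym G e)
                 ; (inj₂ (inj₁ (p , q))) → inj₂ (inj₂ (q , p))
                 ; (inj₂ (inj₂ (p , q))) → inj₂ (inj₁ (q , p)) }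
  ; ~-irrefl = λ { eq   (inj₁ e)                 → ~-irrefl G eq e
                 ; refl (inj₂ (inj₁ (p , q))) → a≢b (trans (sym p) q)
                 ; refl (inj₂ (inj₂ (p , q))) → a≢b (trans (sym q) p) }
  }

≟-Θ : ∀ {k t} → DecidableEquality (ΘVertex k t)
≟-Θ source      source        = yes refl
≟-Θ source      sink          = no λ ()
≟-Θ source      (inner _ _)   = no λ ()
≟-Θ sink        source        = no λ ()
≟-Θ sink        sink          = yes refl
≟-Θ sink        (inner _ _)   = no λ ()
≟-Θ (inner _ _) source        = no λ ()
≟-Θ (inner _ _) sink          = no λ ()
≟-Θ (inner i j) (inner i′ j′) =
  map′ (λ { (refl , refl) → refl }) (λ { refl → refl , refl }) ((i Fin.≟ i′) ×-dec (j Fin.≟ j′))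

≟-apices : DecidableEquality V → DecidableEquality (WithApices V)
≟-apices _≟_ (old u) (old v) = map′ (cong old) (λ { refl → refl }) (u ≟ v)
≟-apices _≟_ (old u) x       = no λ ()
≟-apices _≟_ (old u) y       = no λ ()
≟-apices _≟_ x       (old v) = no λ ()
≟-apices _≟_ x       x       = yes refl
≟-apices _≟_ x       y       = no λ ()
≟-apices _≟_ y       (old v) = no λ ()
≟-apices _≟_ y       x       = no λ ()
≟-apices _≟_ y       y       = yes refl

E : ∀ k t → Graph (WithApices (ΘVertex k t))
E k t = addApices (θ k t) (θ-bipartition k t)

E⁺ : ∀ k t → Graph (WithApices (ΘVertex k t))
E⁺ k t = addEdge (E k t) (≟-apices ≟-Θ) x y λ ()

instance
  Θ-finite : ∀ {k t} → Finite (ΘVertex k t)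
  Θ-finite {k} {t} = record
    { order = 2 + t * (k ∸ 1) ; enumeration = mk↔ₛ′ to from to-from from-to }
    where
    to : ΘVertex k t → Fin (2 + t * (k ∸ 1))
    to source      = zero
    to sink        = suc zero
    to (inner i j) = suc (suc (Fin.combine i j))
    from : Fin (2 + t * (k ∸ 1)) → ΘVertex k t
    from zero          = source
    from (suc zero)    = sink
    from (suc (suc p)) = inner (Fin.quotient (k ∸ 1) p) (Fin.remainder {t} (k ∸ 1) p)
    to-from : ∀ p → to (from p) ≡ p
    to-from zero          = refl
    to-from (suc zero)    = refl
    to-from (suc (suc p)) = cong (λ q → suc (suc q)) (Fin.combine-remQuot {t} (k ∸ 1) p)
    from-to : ∀ v → from (to v) ≡ v
    from-to source      = refl
    from-to sink        = refl
    from-to (inner i j) =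
      cong (λ (a , b) → inner a b) (Fin.remQuot-combine {t} i j)

  apices-finite : ∀ {V} → ⦃ Finite V ⦄ → Finite (WithApices V)
  apices-finite {V} ⦃ fin ⦄ = record
    { order = 2 + order ; enumeration = mk↔ₛ′ to′ from′ to-from from-to }
    where
    open Finite fin
    open Inverse enumeration
    to′ : WithApices V → Fin (2 + order)
    to′ x       = zero
    to′ y       = suc zero
    to′ (old v) = suc (suc (to v))
    from′ : Fin (2 + order) → WithApices V
    from′ zero          = x
    from′ (suc zero)    = y
    from′ (suc (suc p)) = old (from p)
    to-from : ∀ p → to′ (from′ p) ≡ p
    to-from zero          = refl
    to-from (suc zero)    = refl
    to-from (suc (suc p)) = cong (λ q → suc (suc q)) (strictlyInverseˡ p)
    from-to : ∀ v → from′ (to′ v) ≡ v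
    from-to x       = refl
    from-to y       = refl
    from-to (old v) = cong old (strictlyInverseʳ v)

  E⁺-hasEdge : ∀ {k t} → HasEdge (E⁺ k t)
  E⁺-hasEdge = edge {source′ = x} {target′ = y} (inj₂ (inj₁ (refl , refl)))

------------------------------------------------------------------------
-- Asymptotics

-- f(n) = O(n^(p/q)) as n → ∞, for q ≥ 1.  Raising f(n) ≤ c n^(p/q) to the q-th
-- power gives f(n)^q ≤ c^q n^p; the constant C below stands for c^q, rounded up.
_=O[n^_/_] : (ℕ → ℕ) → (p q : ℕ) → Set
f =O[n^ p / q ] = ∃₂ λ C N → ∀ n → N ≤ n → f n ^ q ≤ C * n ^ p

{-# OPTIONS --safe #-}
module Submission where

-- Write e for the number of edges of an E⁺-free graph on n vertices, first made
-- bipartite by a half cut.  If all degrees are at most d ≈ e/n, then for every edge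
-- pq the bipartite graph between N(p) and N(q) contains no θ (p, q would complete it
-- to E⁺), so it has O(d^(1+1/k)) edges.  Hence there are O(e d^(1+1/k)) homomorphic
-- copies of C₄, whereas the Cauchy–Schwarz inequality gives at least e⁴/n⁴; compare
-- the two.  The degrees are bounded without a regularisation lemma: each vertex is
-- split into copies that share out its neighbours, d to a copy, which preserves e
-- and at most doubles n, and neighbourhoods of copies are subsets of neighbourhoods.
--
-- The bound for θ-free bipartite graphs is the argument of Faudree and Simonovits:
-- pass to a subgraph of large minimum degree, and show that the levels of a
-- breadth-first tree grow by a constant factor, since two consecutive levels span
-- only linearly many edges.  For the latter, call a vertex y spread if its
-- neighbours in the level above lie in many branches below their common ancestor a
-- at a given depth.  If the spread vertices have many edges, t disjoint paths of
-- equal length from one vertex in a subgraph of large minimum degree, each continued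
-- to a new branch and along the tree to a, form a θ.  Otherwise keep for every y only
-- its heaviest branch, which costs a constant factor and lowers the depth of the tree.

open import Defs hiding (E) renaming (x to x⋆; y to y⋆)
open import Data.Bool using (Bool; true; false; if_then_else_; not; _∧_; _∨_; _xor_)
open import Data.Bool.Properties using
  (∧-comm; ∧-identityʳ; ∧-zeroʳ; ∨-comm; ∨-zeroʳ; xor-comm; not-involutive)
  renaming (_≟_ to _≟ᵇ_)
open import Data.Fin using (Fin; zero; suc; toℕ)
import Data.Fin as Fin
import Data.Fin.Properties as Fin
open import Data.List using
  (List; []; _∷_; _++_; allFin; cartesianProduct; concatMap; filter; length; map; upTo)
open import Data.List.Membership.Propositional using (_∈_; _∉_; find)
open import Data.List.Membership.Propositional.Properties using
  (∈-∃++; ∈-++⁺ˡ; ∈-++⁺ʳ; ∈-map⁺; ∈-upTo⁺)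
open import Data.List.Properties using (length-++; length-map; length-tabulate; length-upTo)
open import Data.List.Relation.Binary.Permutation.Propositional using (_↭_; ↭⇒↭ₛ)
import Data.List.Relation.Binary.Permutation.Propositional.Properties as ↭
import Data.List.Relation.Binary.Permutation.Setoid.Properties as ↭ₛ
open import Data.List.Relation.Unary.All as All using (All; []; _∷_)
open import Data.List.Relation.Unary.All.Properties using (¬Any⇒All¬)
open import Data.List.Relation.Unary.AllPairs using ([]; _∷_)
open import Data.List.Relation.Unary.Any as Any using (Any; here; there)
open import Data.List.Relation.Unary.Unique.Propositional using (Unique)
import Data.List.Relation.Unary.Unique.Propositional.Properties as Unique
open import Data.Nat hiding (_/_; _%_)
open import Data.Nat.DivMod using (_/_; _%_; m≡m%n+[m/n]*n; m%n<n; m/n*n≤m)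
open import Data.Nat.ListAction using (sum)
open import Data.Nat.ListAction.Properties using (sum-↭)
open import Data.Nat.Properties
open import Data.Nat.Tactic.RingSolver using (solve-∀)
open import Data.Parity.Base using (0ℙ; 1ℙ)
open import Data.Product using (∃; _×_; _,_; proj₁; proj₂)
open import Data.Sum using (_⊎_; inj₁; inj₂)
open import Function using (_∘_; id)
open import Relation.Binary using (DecidableEquality)
open import Relation.Binary.PropositionalEquality
open import Relation.Nullary using (Dec; yes; no; ¬_; does; contradiction)
open import Relation.Nullary.Decidable using (dec-true; dec-false)
import Relation.Unary as U

private variable A B : Set

-- Booleans and decidable statements.

does-true : {P : Set} (d : Dec P) → does d ≡ true → P
does-true (yes p) _ = p

does-false : {P : Set} (d : Dec P) → does d ≡ false → ¬ P
does-false (no ¬p) _ = ¬p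

∧-true : ∀ {a b} → a ∧ b ≡ true → a ≡ true × b ≡ true
∧-true {true} {true} _ = refl , refl

not-≢ : ∀ b → not b ≢ b
not-≢ true  ()
not-≢ false ()

≟-refl : ∀ {m n} → m ≡ n → does (m ≟ n) ≡ true
≟-refl {m} {n} = dec-true (m ≟ n)

-- Finite sums

∑ : List A → (A → ℕ) → ℕ
∑ xs f = sum (map f xs)

syntax ∑ xs (λ x → e) = ∑[ x ∈ xs ] e
infix 5 ∑

𝟙 : Bool → ℕ
𝟙 true  = 1
𝟙 false = 0

𝟙≤1 : ∀ b → 𝟙 b ≤ 1
𝟙≤1 true  = ≤-refl
𝟙≤1 false = z≤n

𝟙-∧ : ∀ a b → 𝟙 (a ∧ b) ≡ 𝟙 a * 𝟙 b
𝟙-∧ true  b = sym (+-identityʳ _)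
𝟙-∧ false b = refl

𝟙-≤ : ∀ {b m} → (b ≡ true → 1 ≤ m) → 𝟙 b ≤ m
𝟙-≤ {true}  f = f refl
𝟙-≤ {false} f = z≤n

*𝟙-≤ : ∀ {q b m} → (b ≡ true → q ≤ m) → q * 𝟙 b ≤ m
*𝟙-≤ {q} {true}  f = ≤-trans (≤-reflexive (*-identityʳ q)) (f refl)
*𝟙-≤ {q} {false} f = ≤-trans (≤-reflexive (*-zeroʳ q)) z≤n

∑-mono-∈ : ∀ (xs : List A) {f g : A → ℕ} → (∀ {x} → x ∈ xs → f x ≤ g x) → ∑ xs f ≤ ∑ xs g
∑-mono-∈ []       le = z≤n
∑-mono-∈ (x ∷ xs) le = +-mono-≤ (le (here refl)) (∑-mono-∈ xs (le ∘ there))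

∑-mono : ∀ (xs : List A) {f g : A → ℕ} → (∀ x → f x ≤ g x) → ∑ xs f ≤ ∑ xs g
∑-mono xs le = ∑-mono-∈ xs λ {x} _ → le x

∑-cong-∈ : ∀ (xs : List A) {f g : A → ℕ} → (∀ {x} → x ∈ xs → f x ≡ g x) → ∑ xs f ≡ ∑ xs g
∑-cong-∈ []       eq = refl
∑-cong-∈ (x ∷ xs) eq = cong₂ _+_ (eq (here refl)) (∑-cong-∈ xs (eq ∘ there))

∑-cong : ∀ (xs : List A) {f g : A → ℕ} → (∀ x → f x ≡ g x) → ∑ xs f ≡ ∑ xs g
∑-cong xs eq = ∑-cong-∈ xs λ {x} _ → eq x

∑-+ : ∀ (xs : List A) (f g : A → ℕ) → (∑[ x ∈ xs ] (f x + g x)) ≡ ∑ xs f + ∑ xs g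
∑-+ []       f g = refl
∑-+ (x ∷ xs) f g = begin
  f x + g x + ∑ xs (λ x → f x + g x)  ≡⟨ cong (f x + g x +_) (∑-+ xs f g) ⟩
  f x + g x + (∑ xs f + ∑ xs g)       ≡⟨ swap⁴ (f x) (g x) (∑ xs f) (∑ xs g) ⟩
  f x + ∑ xs f + (g x + ∑ xs g)       ∎
  where
  open ≡-Reasoning
  swap⁴ : ∀ a b c d → a + b + (c + d) ≡ a + c + (b + d)
  swap⁴ = solve-∀

∑-*ˡ : ∀ (xs : List A) c (f : A → ℕ) → (∑[ x ∈ xs ] (c * f x)) ≡ c * ∑ xs f
∑-*ˡ []       c f = sym (*-zeroʳ c)
∑-*ˡ (x ∷ xs) c f = trans (cong (c * f x +_) (∑-*ˡ xs c f)) (sym (*-distribˡ-+ c (f x) _))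

∑-*ʳ : ∀ (xs : List A) (f : A → ℕ) c → (∑[ x ∈ xs ] (f x * c)) ≡ ∑ xs f * c
∑-*ʳ xs f c = trans (∑-cong xs λ x → *-comm (f x) c) (trans (∑-*ˡ xs c f) (*-comm c _))

∑-const : ∀ (xs : List A) c → (∑[ x ∈ xs ] c) ≡ length xs * c
∑-const []       c = refl
∑-const (x ∷ xs) c = cong (c +_) (∑-const xs c)

∑-zero : ∀ (xs : List A) → (∑[ x ∈ xs ] 0) ≡ 0
∑-zero xs = trans (∑-const xs 0) (*-zeroʳ (length xs))

∑-≤-const : ∀ (xs : List A) {f : A → ℕ} {c} → (∀ {x} → x ∈ xs → f x ≤ c) → ∑ xs f ≤ length xs * c
∑-≤-const xs {c = c} le = ≤-trans (∑-mono-∈ xs le) (≤-reflexive (∑-const xs c))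

∑-comm : ∀ (xs : List A) (ys : List B) (f : A → B → ℕ) →
         (∑[ x ∈ xs ] ∑[ y ∈ ys ] f x y) ≡ (∑[ y ∈ ys ] ∑[ x ∈ xs ] f x y)
∑-comm []       ys f = sym (∑-zero ys)
∑-comm (x ∷ xs) ys f = trans (cong (∑ ys (f x) +_) (∑-comm xs ys f)) (sym (∑-+ ys (f x) _))

∑-++ : ∀ (xs ys : List A) (f : A → ℕ) → ∑ (xs ++ ys) f ≡ ∑ xs f + ∑ ys f
∑-++ []       ys f = refl
∑-++ (x ∷ xs) ys f = trans (cong (f x +_) (∑-++ xs ys f)) (sym (+-assoc (f x) _ _))

∑-map : ∀ (g : B → A) (xs : List B) (f : A → ℕ) → ∑ (map g xs) f ≡ ∑ xs (f ∘ g)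
∑-map g []       f = refl
∑-map g (x ∷ xs) f = cong (f (g x) +_) (∑-map g xs f)

∑-↭ : ∀ {xs ys : List A} (f : A → ℕ) → xs ↭ ys → ∑ xs f ≡ ∑ ys f
∑-↭ f p = sum-↭ (↭.map⁺ f p)

≤∑ : ∀ {xs : List A} (f : A → ℕ) {x} → x ∈ xs → f x ≤ ∑ xs f
≤∑ f (here refl)          = m≤m+n _ _
≤∑ f (there {x = y} x∈xs) = ≤-trans (≤∑ f x∈xs) (m≤n+m _ (f y))

∑-pos : ∀ (xs : List A) (f : A → ℕ) → 0 < ∑ xs f → ∃ λ x → x ∈ xs × 0 < f x
∑-pos (x ∷ xs) f pos with f x in eq
... | suc m = x , here refl , subst (0 <_) (sym eq) (s≤s z≤n)
... | zero  with ∑-pos xs f pos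
...   | y , y∈ , p = y , there y∈ , p

∑-filter : ∀ (P : A → Bool) (xs : List A) (f : A → ℕ) →
           ∑ (filter (λ x → P x ≟ᵇ true) xs) f ≡ (∑[ x ∈ xs ] (𝟙 (P x) * f x))
∑-filter P []       f = refl
∑-filter P (x ∷ xs) f with P x
... | true  = cong₂ _+_ (sym (+-identityʳ (f x))) (∑-filter P xs f)
... | false = ∑-filter P xs f

length≡∑ : ∀ (xs : List A) → length xs ≡ (∑[ x ∈ xs ] 1)
length≡∑ xs = sym (trans (∑-const xs 1) (*-identityʳ _))

length-filter≡∑ : ∀ (P : A → Bool) (xs : List A) →
                  length (filter (λ x → P x ≟ᵇ true) xs) ≡ (∑[ x ∈ xs ] 𝟙 (P x))
length-filter≡∑ P xs = trans (length≡∑ (filter _ xs)) (trans (∑-filter P xs _) (∑-cong xs λ x → *-identityʳ _))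

-- Counting in lists without repetitions.

module _ (_≟_ : DecidableEquality A) where

  ∑-≟-∉ : ∀ {xs : List A} {v} → v ∉ xs → (∑[ x ∈ xs ] 𝟙 (does (x ≟ v))) ≡ 0
  ∑-≟-∉ {xs} {v} v∉ = trans (∑-cong-∈ xs off) (∑-zero xs)
    where
    off : ∀ {x} → x ∈ xs → 𝟙 (does (x ≟ v)) ≡ 0
    off {x} x∈ with x ≟ v
    ... | yes refl = contradiction x∈ v∉
    ... | no _     = refl

  ∑-≟-≤1 : ∀ {xs : List A} → Unique xs → ∀ v → (∑[ x ∈ xs ] 𝟙 (does (x ≟ v))) ≤ 1
  ∑-≟-≤1 []                    v = z≤n
  ∑-≟-≤1 {x ∷ xs} (x∉xs ∷ uniq) v with x ≟ v
  ... | yes refl = ≤-reflexive (cong suc (∑-≟-∉ λ x∈ → All.lookup x∉xs x∈ refl))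
  ... | no _     = ∑-≟-≤1 uniq v

  ∑-≟-≡ : ∀ {xs : List A} → Unique xs → ∀ {v} → v ∈ xs → (∑[ x ∈ xs ] 𝟙 (does (x ≟ v))) ≡ 1
  ∑-≟-≡ {xs} uniq {v} v∈ = ≤-antisym (∑-≟-≤1 uniq v)
    (≤-trans (≤-reflexive (cong 𝟙 (sym (dec-true (v ≟ v) refl)))) (≤∑ (λ x → 𝟙 (does (x ≟ v))) v∈))

  ∈? : List A → A → Bool
  ∈? ys x = does (Any.any? (x ≟_) ys)

  ∑-∈-≤ : ∀ {xs : List A} → Unique xs → ∀ ys → (∑[ x ∈ xs ] 𝟙 (∈? ys x)) ≤ length ys
  ∑-∈-≤ {xs} uniq ys = begin
    ∑ xs (λ x → 𝟙 (∈? ys x))                   ≤⟨ ∑-mono xs hit ⟩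
    ∑ xs (λ x → ∑ ys (λ y → 𝟙 (does (x ≟ y))))      ≡⟨ ∑-comm xs ys _ ⟩
    ∑ ys (λ y → ∑ xs (λ x → 𝟙 (does (x ≟ y))))      ≤⟨ ∑-≤-const ys (λ {y} _ → ∑-≟-≤1 uniq y) ⟩
    length ys * 1                              ≡⟨ *-identityʳ _ ⟩
    length ys                                  ∎
    where
    open ≤-Reasoning
    hit : ∀ x → 𝟙 (∈? ys x) ≤ ∑ ys (λ y → 𝟙 (does (x ≟ y)))
    hit x with Any.any? (x ≟_) ys
    ... | no _   = z≤n
    ... | yes x∈ = ≤-trans (≤-reflexive (cong 𝟙 (sym (dec-true (x ≟ x) refl)))) (≤∑ (λ y → 𝟙 (does (x ≟ y))) x∈)

  -- Pigeonhole, since `ys` accounts for at most `length ys` entries of a list without repetitions.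
  -- All greedy choices rest on it: a neighbour off a forbidden list exists once the degree exceeds
  -- the length of that list.
  choose-outside : ∀ {xs : List A} → Unique xs → ∀ (P : A → Bool) ys →
                   length ys < (∑[ x ∈ xs ] 𝟙 (P x)) →
                   ∃ λ x → x ∈ xs × P x ≡ true × x ∉ ys
  choose-outside {xs} uniq P ys lt
    with ∑-pos xs (λ x → 𝟙 (P x ∧ not (∈? ys x))) pos
    where
    split : ∀ x → 𝟙 (P x) ≤ 𝟙 (P x ∧ not (∈? ys x)) + 𝟙 (∈? ys x)
    split x with P x | ∈? ys x
    ... | true  | true  = ≤-refl
    ... | true  | false = ≤-refl
    ... | false | _     = z≤n
    pos : 0 < ∑ xs (λ x → 𝟙 (P x ∧ not (∈? ys x)))
    pos = +-cancelʳ-< (length ys) _ _ (<-≤-trans lt (begin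
      ∑ xs (λ x → 𝟙 (P x))  ≤⟨ ∑-mono xs split ⟩
      _                     ≡⟨ ∑-+ xs _ _ ⟩
      _                     ≤⟨ +-monoʳ-≤ (∑ xs (λ x → 𝟙 (P x ∧ not (∈? ys x)))) (∑-∈-≤ uniq ys) ⟩
      _                     ∎))
      where open ≤-Reasoning
  ... | x , x∈ , p with P x in eq | Any.any? (x ≟_) ys
  ...   | true | no x∉ = x , x∈ , eq , x∉

-- Cauchy-Schwarz and homomorphisms from the four-cycle.

2ab≤a²+b² : ∀ a b → 2 * (a * b) ≤ a * a + b * b
2ab≤a²+b² a b with ≤-total a b
... | inj₁ a≤b = subst (λ b → 2 * (a * b) ≤ a * a + b * b) (m+[n∸m]≡n a≤b)
                   (≤-trans (m≤m+n _ _) (≤-reflexive (square a (b ∸ a))))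
  where
  square : ∀ a c → 2 * (a * (a + c)) + c * c ≡ a * a + (a + c) * (a + c)
  square = solve-∀
... | inj₂ b≤a = subst (λ a → 2 * (a * b) ≤ a * a + b * b) (m+[n∸m]≡n b≤a)
                   (≤-trans (m≤m+n _ _) (≤-reflexive (square b (a ∸ b))))
  where
  square : ∀ a c → 2 * ((a + c) * a) + c * c ≡ (a + c) * (a + c) + a * a
  square = solve-∀

∑-*-∑ : ∀ (xs : List A) (ys : List B) f g →
        ∑ xs f * ∑ ys g ≡ (∑[ x ∈ xs ] ∑[ y ∈ ys ] (f x * g y))
∑-*-∑ xs ys f g = sym (trans (∑-cong xs λ x → ∑-*ˡ ys (f x) g) (∑-*ʳ xs f (∑ ys g)))

-- The square of the sum is a double sum of products `f x * f y`; twice each product is at most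
-- `f x * f x + f y * f y`, and each of the two squares sums to the right-hand side.
cauchy-schwarz : ∀ (xs : List A) f → ∑ xs f * ∑ xs f ≤ length xs * (∑[ x ∈ xs ] (f x * f x))
cauchy-schwarz xs f = *-cancelˡ-≤ 2 (begin
  2 * (∑ xs f * ∑ xs f)
    ≡⟨ cong (2 *_) (∑-*-∑ xs xs f f) ⟩
  2 * ∑ xs (λ x → ∑ xs (λ y → f x * f y))
    ≡⟨ trans (∑-cong xs (λ x → ∑-*ˡ xs 2 _)) (∑-*ˡ xs 2 _) ⟨
  ∑ xs (λ x → ∑ xs (λ y → 2 * (f x * f y)))
    ≤⟨ ∑-mono xs (λ x → ∑-mono xs λ y → 2ab≤a²+b² (f x) (f y)) ⟩
  ∑ xs (λ x → ∑ xs (λ y → f x * f x + f y * f y))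
    ≡⟨ ∑-cong xs (λ x → trans (∑-+ xs _ _) (cong (_+ _) (∑-const xs _))) ⟩
  ∑ xs (λ x → length xs * (f x * f x) + ∑ xs (λ y → f y * f y))
    ≡⟨ trans (∑-+ xs _ _) (cong₂ _+_ (∑-*ˡ xs (length xs) _) (∑-const xs _)) ⟩
  Q + Q
    ≡⟨ cong (Q +_) (+-identityʳ Q) ⟨
  2 * Q ∎)
  where
  open ≤-Reasoning
  Q = length xs * ∑ xs (λ x → f x * f x)

-- The number of homomorphisms from C₄ is ∑ codeg², and ∑ codeg = ∑ deg².
sidorenko-C₄ : ∀ (xs : List A) (b : A → A → ℕ) →
  (∑[ p ∈ xs ] ∑[ q ∈ xs ] b p q) ^ 4 ≤
  length xs ^ 4 * (∑[ p ∈ xs ] ∑[ q ∈ xs ] ((∑[ r ∈ xs ] (b r p * b r q)) * (∑[ r ∈ xs ] (b r p * b r q))))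
sidorenko-C₄ {A = A} xs b = begin
  e ^ 4                      ≡⟨ pow4 e ⟩
  (e * e) * (e * e)          ≤⟨ *-mono-≤ step₁ step₁ ⟩
  (s * K) * (s * K)          ≡⟨ arr s K ⟩
  (s * s) * (K * K)          ≤⟨ *-monoʳ-≤ (s * s) step₂ ⟩
  (s * s) * (s * (s * H))    ≡⟨ arr′ s H ⟩
  s ^ 4 * H                  ∎
  where
  open ≤-Reasoning
  s e K H : ℕ
  s = length xs
  e = ∑[ p ∈ xs ] ∑[ q ∈ xs ] b p q
  cod : A → A → ℕ
  cod p q = ∑[ r ∈ xs ] (b r p * b r q)
  K = ∑[ p ∈ xs ] ∑[ q ∈ xs ] cod p q
  H = ∑[ p ∈ xs ] ∑[ q ∈ xs ] (cod p q * cod p q)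
  pow4 : ∀ a → a * (a * (a * (a * 1))) ≡ (a * a) * (a * a)
  pow4 = solve-∀
  arr : ∀ s k → (s * k) * (s * k) ≡ (s * s) * (k * k)
  arr = solve-∀
  arr′ : ∀ s h → (s * s) * (s * (s * h)) ≡ s * (s * (s * (s * 1))) * h
  arr′ = solve-∀
  step₁ : e * e ≤ s * K
  step₁ = begin
    e * e  ≤⟨ cauchy-schwarz xs _ ⟩
    s * (∑[ r ∈ xs ] (∑ xs (b r) * ∑ xs (b r)))
      ≡⟨ cong (s *_) (∑-cong xs λ r → ∑-*-∑ xs xs (b r) (b r)) ⟩
    s * (∑[ r ∈ xs ] ∑[ p ∈ xs ] ∑[ q ∈ xs ] (b r p * b r q))
      ≡⟨ cong (s *_) (trans (∑-comm xs xs _) (∑-cong xs λ p → ∑-comm xs xs _)) ⟩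
    s * K  ∎
  step₂ : K * K ≤ s * (s * H)
  step₂ = begin
    K * K ≤⟨ cauchy-schwarz xs _ ⟩
    s * (∑[ p ∈ xs ] (∑ xs (cod p) * ∑ xs (cod p)))
      ≤⟨ *-monoʳ-≤ s (∑-mono xs λ p → cauchy-schwarz xs (cod p)) ⟩
    s * (∑[ p ∈ xs ] (s * (∑[ q ∈ xs ] (cod p q * cod p q))))
      ≡⟨ cong (s *_) (∑-*ˡ xs s _) ⟩
    s * (s * H) ∎

-- Theta graphs from internally disjoint paths

record Θ-in {V : Set} (h : V → V → Bool) (k t : ℕ) : Set where
  field
    place     : ΘVertex k t → V
    injective : ∀ {u v} → place u ≡ place v → u ≡ v
    hom       : ∀ {u v} → Step k t u v → h (place u) (place v) ≡ true

module _ {V : Set} (h : V → V → Bool) (a : V) where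

  -- A path from w to a with m inner vertices, none of them in U.
  data Leg : List V → V → ℕ → Set where
    end  : ∀ {U w} → h w a ≡ true → Leg U w 0
    step : ∀ {U w v m} → h w v ≡ true → v ∉ U → Leg (v ∷ U) v m → Leg U w (suc m)

  vertex : ∀ {U w m} → Leg U w m → Fin m → V
  vertex (step {v = v} _ _ l) zero    = v
  vertex (step _ _ l)         (suc i) = vertex l i

  vertices : ∀ {U w m} → Leg U w m → List V
  vertices (end _)              = []
  vertices (step {v = v} _ _ l) = v ∷ vertices l

  length-vertices : ∀ {U w m} (l : Leg U w m) → length (vertices l) ≡ m
  length-vertices (end _)      = refl
  length-vertices (step _ _ l) = cong suc (length-vertices l)

  vertex∈vertices : ∀ {U w m} (l : Leg U w m) i → vertex l i ∈ vertices l
  vertex∈vertices (step _ _ l) zero    = here refl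
  vertex∈vertices (step _ _ l) (suc i) = there (vertex∈vertices l i)

  vertex-∉ : ∀ {U w m} (l : Leg U w m) i → vertex l i ∉ U
  vertex-∉ (step _ v∉ l) zero    = v∉
  vertex-∉ (step _ v∉ l) (suc i) = vertex-∉ l i ∘ there

  -- Every later vertex avoids the forbidden list, which by then contains the earlier ones.
  vertex-injective : ∀ {U w m} (l : Leg U w m) {i j} → vertex l i ≡ vertex l j → i ≡ j
  vertex-injective (step _ _ l) {zero}  {zero}  eq = refl
  vertex-injective (step _ _ l) {zero}  {suc j} eq = contradiction (here (sym eq)) (vertex-∉ l j)
  vertex-injective (step _ _ l) {suc i} {zero}  eq = contradiction (here eq) (vertex-∉ l i)
  vertex-injective (step _ _ l) {suc i} {suc j} eq = cong suc (vertex-injective l eq)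

  vertex-first : ∀ {U w m} (l : Leg U w m) {i} → toℕ i ≡ 0 → h w (vertex l i) ≡ true
  vertex-first (step e _ l) {zero} _ = e

  vertex-next : ∀ {U w m} (l : Leg U w m) {i j} → toℕ j ≡ suc (toℕ i) →
                h (vertex l i) (vertex l j) ≡ true
  vertex-next (step _ _ l) {zero}  {suc j} eq = vertex-first l (suc-injective eq)
  vertex-next (step _ _ l) {suc i} {suc j} eq = vertex-next l (suc-injective eq)

  vertex-last : ∀ {U w m} (l : Leg U w m) {i} → suc (toℕ i) ≡ m → h (vertex l i) a ≡ true
  vertex-last (step _ _ (end e))         {zero}  _  = e
  vertex-last (step _ _ l@(step _ _ _))  {suc i} eq = vertex-last l (suc-injective eq)

  -- The forbidden list grows by the inner vertices of each leg, so that the legs are internally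
  -- disjoint by construction.
  data Legs (w : V) (m : ℕ) : List V → ℕ → Set where
    []  : ∀ {U} → Legs w m U 0
    _∷_ : ∀ {U t} (l : Leg U w m) → Legs w m (vertices l ++ U) t → Legs w m U (suc t)

  -- Greedy construction: `N` is the total size up to which a further leg can still be found, and
  -- `t` legs consume `t * m` of it.
  build-legs : ∀ {w m N} → (∀ U → length U + m ≤ N → Leg U w m) →
               ∀ t U → length U + t * m ≤ N → Legs w m U t
  build-legs         leg zero    U le = []
  build-legs {m = m} leg (suc t) U le =
    l ∷ build-legs leg t (vertices l ++ U) (≤-trans (≤-reflexive len) le)
    where
    l = leg U (≤-trans (+-monoʳ-≤ (length U) (m≤m+n m (t * m))) le)
    arr : ∀ m u q → (m + u) + q ≡ u + (m + q)
    arr = solve-∀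
    len : length (vertices l ++ U) + t * m ≡ length U + (m + t * m)
    len = trans (cong (_+ t * m) (trans (length-++ (vertices l)) (cong (_+ length U) (length-vertices l))))
                (arr m (length U) (t * m))

  module _ {w : V} {m : ℕ} where

    place-inner : ∀ {U t} → Legs w m U t → Fin t → Fin m → V
    place-inner (l ∷ ls) zero    = vertex l
    place-inner (l ∷ ls) (suc i) = place-inner ls i

    place-inner-∉ : ∀ {U t} (ls : Legs w m U t) i j → place-inner ls i j ∉ U
    place-inner-∉ (l ∷ ls) zero    j = vertex-∉ l j
    place-inner-∉ (l ∷ ls) (suc i) j = place-inner-∉ ls i j ∘ ∈-++⁺ʳ (vertices l)

    place-inner-injective : ∀ {U t} (ls : Legs w m U t) {i j i′ j′} →
      place-inner ls i j ≡ place-inner ls i′ j′ → i ≡ i′ × j ≡ j′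
    place-inner-injective (l ∷ ls) {zero}  {j} {zero}   {j′} eq = refl , vertex-injective l eq
    place-inner-injective (l ∷ ls) {zero}  {j} {suc i′} {j′} eq = contradiction
      (∈-++⁺ˡ (subst (_∈ vertices l) eq (vertex∈vertices l j))) (place-inner-∉ ls i′ j′)
    place-inner-injective (l ∷ ls) {suc i} {j} {zero}   {j′} eq = contradiction
      (∈-++⁺ˡ (subst (_∈ vertices l) (sym eq) (vertex∈vertices l j′))) (place-inner-∉ ls i j)
    place-inner-injective (l ∷ ls) {suc i} {j} {suc i′} {j′} eq with place-inner-injective ls eq
    ... | refl , refl = refl , refl

    leg-property : ∀ {P : (Fin m → V) → Set} → (∀ {U} (l : Leg U w m) → P (vertex l)) →
                   ∀ {U t} (ls : Legs w m U t) i → P (place-inner ls i)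
    leg-property pr (l ∷ ls) zero    = pr l
    leg-property {P = P} pr (l ∷ ls) (suc i) = leg-property {P = P} pr ls i

  -- Starting from the forbidden list `w ∷ a ∷ []` keeps both ends of the theta off the inner
  -- vertices.
  legs⇒Θ : ∀ {w k t} → w ≢ a → Legs w (k ∸ 1) (w ∷ a ∷ []) t → Θ-in h k t
  legs⇒Θ {w} {k} {t} w≢a ls = record
    { place     = place
    ; injective = λ {u} {v} → inj u v
    ; hom       = hom
    }
    where
    place : ΘVertex k t → V
    place source      = w
    place sink        = a
    place (inner i j) = place-inner ls i j
    inj : ∀ u v → place u ≡ place v → u ≡ v
    inj source      source        eq = refl
    inj source      sink          eq = contradiction eq w≢a
    inj source      (inner i j)   eq = contradiction (here (sym eq)) (place-inner-∉ ls i j)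
    inj sink        source        eq = contradiction (sym eq) w≢a
    inj sink        sink          eq = refl
    inj sink        (inner i j)   eq = contradiction (there (here (sym eq))) (place-inner-∉ ls i j)
    inj (inner i j) source        eq = contradiction (here eq) (place-inner-∉ ls i j)
    inj (inner i j) sink          eq = contradiction (there (here eq)) (place-inner-∉ ls i j)
    inj (inner i j) (inner i′ j′) eq with place-inner-injective ls eq
    ... | refl , refl = refl
    hom : ∀ {u v} → Step k t u v → h (place u) (place v) ≡ true
    hom (first {i} eq) = leg-property {P = λ g → ∀ j → toℕ j ≡ 0 → h w (g j) ≡ true}
      (λ l j → vertex-first l) ls i _ eq
    hom (next {i} eq) = leg-property
      {P = λ g → ∀ j j′ → toℕ j′ ≡ suc (toℕ j) → h (g j) (g j′) ≡ true}
      (λ l j j′ → vertex-next l) ls i _ _ eq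
    hom (last {i} eq) = leg-property {P = λ g → ∀ j → suc (toℕ j) ≡ k ∸ 1 → h (g j) a ≡ true}
      (λ l j → vertex-last l) ls i _ (cong (_∸ 1) eq)

-- Subgraphs of large minimum degree

Unique-resp-↭ : ∀ {xs ys : List A} → xs ↭ ys → Unique xs → Unique ys
Unique-resp-↭ p = ↭ₛ.Unique-resp-↭ (setoid _) (↭⇒↭ₛ p)

∈⇒↭-∷ : ∀ {v : A} {xs} → v ∈ xs → ∃ λ ys → xs ↭ v ∷ ys
∈⇒↭-∷ {v = v} v∈ with ∈-∃++ v∈
... | as , bs , refl = as ++ bs , ↭.shift v as bs

module _ {V : Set} (h : V → V → Bool) where

  degree-in : List V → V → ℕ
  degree-in C v = ∑[ u ∈ C ] 𝟙 (h v u)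

  record Core (q : ℕ) (S : List V) : Set where
    field
      vs         : List V
      unique     : Unique vs
      length≤    : length vs ≤ length S
      {root}     : V
      root∈vs    : root ∈ vs
      min-degree : ∀ {v} → v ∈ vs → q < degree-in vs v

  -- Vertices of degree at most `q` are deleted one by one. By symmetry each deletion lowers the
  -- degree sum by at most `2 * q`, so the strict inequality persists; it fails for the empty list,
  -- hence the process stops earlier.
  core : (∀ u v → h u v ≡ h v u) → ∀ q S → Unique S →
         2 * q * length S < (∑[ v ∈ S ] degree-in S v) → Core q S
  core h-sym q S uniq lt = peel (length S) S ≤-refl uniq lt
    where
    peel : ∀ n S → length S ≤ n → Unique S → 2 * q * length S < ∑ S (degree-in S) → Core q S
    peel n       []        _  _    lt = contradiction lt (λ ())
    peel (suc n) S@(r ∷ _) ≤n uniq lt with Any.any? (λ v → degree-in S v ≤? q) S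
    ... | no none = record
      { vs = S ; unique = uniq ; length≤ = ≤-refl ; root∈vs = here refl
      ; min-degree = λ v∈ → ≰⇒> (All.lookup (¬Any⇒All¬ S none) v∈) }
    ... | yes some with find some
    ...   | v , v∈ , dv≤q with ∈⇒↭-∷ v∈
    ...     | S′ , p = record
      { vs = vs ; unique = unique ; root∈vs = root∈vs ; min-degree = min-degree
      ; length≤ = ≤-trans length≤ (≤-trans (n≤1+n _) (≤-reflexive (sym len))) }
      where
      len : length S ≡ suc (length S′)
      len = ↭.↭-length p
      d e : ℕ
      d = degree-in S′ v
      e = ∑ S′ (degree-in S′)
      dv : 𝟙 (h v v) + d ≤ q
      dv = subst (_≤ q) (∑-↭ _ p) dv≤q
      total : ∑ S (degree-in S) ≡ (𝟙 (h v v) + d) + (d + e)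
      total = begin
        ∑ S (degree-in S)
          ≡⟨ ∑-cong S (λ u → ∑-↭ _ p) ⟩
        ∑ S (degree-in (v ∷ S′))
          ≡⟨ ∑-↭ _ p ⟩
        (𝟙 (h v v) + d) + (∑[ u ∈ S′ ] (𝟙 (h u v) + degree-in S′ u))
          ≡⟨ cong (𝟙 (h v v) + d +_) (∑-+ S′ _ _) ⟩
        (𝟙 (h v v) + d) + ((∑[ u ∈ S′ ] 𝟙 (h u v)) + e)
          ≡⟨ cong (λ z → 𝟙 (h v v) + d + (z + e)) (∑-cong S′ λ u → cong 𝟙 (h-sym u v)) ⟩
        (𝟙 (h v v) + d) + (d + e)
          ∎ where open ≡-Reasoning
      arr : ∀ q l → 2 * q * suc l ≡ (q + q) + 2 * q * l
      arr = solve-∀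
      lt′ : 2 * q * length S′ < e
      lt′ = +-cancelˡ-< (q + q) _ _ (begin-strict
        (q + q) + 2 * q * length S′       ≡⟨ arr q (length S′) ⟨
        2 * q * suc (length S′)           ≡⟨ cong (2 * q *_) len ⟨
        2 * q * length S                  <⟨ lt ⟩
        ∑ S (degree-in S)                 ≡⟨ total ⟩
        (𝟙 (h v v) + d) + (d + e)         ≡⟨ +-assoc (𝟙 (h v v) + d) d e ⟨
        (𝟙 (h v v) + d) + d + e           ≤⟨ +-monoˡ-≤ e (+-mono-≤ dv (≤-trans (m≤n+m d _) dv)) ⟩
        (q + q) + e                       ∎) where open ≤-Reasoning
      uniq′ : Unique S′
      uniq′ with Unique-resp-↭ p uniq
      ... | _ ∷ u = u
      open Core (peel n S′ (s≤s⁻¹ (subst (_≤ suc n) len ≤n)) uniq′ lt′)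

-- The largest class of a colouring

-- The default `d` competes with the entries, so the result need not occur in the list.
argmax : (A → ℕ) → A → List A → A
argmax f d []       = d
argmax f d (x ∷ xs) = if does (f (argmax f d xs) ≤? f x) then x else argmax f d xs

≤-argmax : ∀ (f : A → ℕ) d {xs x} → x ∈ xs → f x ≤ f (argmax f d xs)
≤-argmax f d {y ∷ ys} x∈ with does (f (argmax f d ys) ≤? f y) in eq | x∈
... | true  | here refl = ≤-refl
... | true  | there x∈′ = ≤-trans (≤-argmax f d x∈′) (does-true (f (argmax f d ys) ≤? f y) eq)
... | false | here refl = ≰⇒≥ (does-false (f (argmax f d ys) ≤? f y) eq)
... | false | there x∈′ = ≤-argmax f d x∈′

-- Only the nonzero terms contribute, each at most the maximum. Applied to branches, this says that
-- the heaviest one holds a fair share of the edges.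
∑-≤-support*max : ∀ (xs : List A) f d →
  ∑ xs f ≤ (∑[ x ∈ xs ] 𝟙 (does (0 <? f x))) * f (argmax f d xs)
∑-≤-support*max xs f d = ≤-trans
  (∑-mono-∈ xs λ {x} x∈ → bound (f x) (≤-argmax f d x∈))
  (≤-reflexive (∑-*ʳ xs _ _))
  where
  bound : ∀ {m} n → n ≤ m → n ≤ 𝟙 (does (0 <? n)) * m
  bound zero    le = z≤n
  bound (suc n) le = ≤-trans le (≤-reflexive (sym (+-identityʳ _)))

∑-at-most-one : DecidableEquality A → ∀ {xs : List A} → Unique xs → ∀ (P : A → Bool) →
  (∀ {x y} → P x ≡ true → P y ≡ true → x ≡ y) → (∑[ x ∈ xs ] 𝟙 (P x)) ≤ 1
∑-at-most-one _≟_ {xs} uniq P one with (∑[ x ∈ xs ] 𝟙 (P x)) ≤? 1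
... | yes le = le
... | no ≰1 with choose-outside _≟_ uniq P [] (≤-trans (s≤s z≤n) (≰⇒> ≰1))
...   | x , _ , Px , _ with choose-outside _≟_ uniq P (x ∷ []) (≰⇒> ≰1)
...     | y , _ , Py , y∉ = contradiction (here (one Py Px)) y∉

-- Edges between consecutive levels of a tree

iterate : (A → A) → ℕ → A → A
iterate p zero    v = v
iterate p (suc m) v = iterate p m (p v)

-- In the recursion `2 * τ` pays for the edges at spread vertices, and the factor `τ` for keeping
-- only one of at most `τ` branches at the others.
level-bound : ℕ → ℕ → ℕ
level-bound τ zero    = 1
level-bound τ (suc s) = 2 * τ + τ * level-bound τ s

1≤level-bound : ∀ {τ} s → 1 ≤ τ → 1 ≤ level-bound τ s
1≤level-bound zero    _ = ≤-refl
1≤level-bound {suc τ} (suc s) _ = s≤s z≤n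

size : {V : Set} → List V → (V → ℕ) → ℕ → ℕ
size vs lev m = ∑[ v ∈ vs ] 𝟙 (does (lev v ≟ m))

-- p is the parent function of a tree, and lev the depth.
module Tree {V : Set} (_≟v_ : DecidableEquality V)
  (h : V → V → Bool) (h-sym : ∀ u v → h u v ≡ h v u)
  (vs : List V) (uniq : Unique vs)
  (p : V → V) (p-closed : ∀ {v} → v ∈ vs → p v ∈ vs)
  (lev : V → ℕ) (i : ℕ)
  (parent : ∀ {v m} → lev v ≡ suc m → suc m ≤ i → h v (p v) ≡ true × lev (p v) ≡ m)
  (k t : ℕ) (i<k : i < k)
  where

  Good : (V → V → Bool) → Set
  Good F = ∀ {x y} → F x y ≡ true → lev x ≡ i × lev y ≡ suc i × h x y ≡ true

  -- An upper bound for the number of vertices of `θ k t`, and so for the length of the forbidden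
  -- list at every stage of the greedy construction.
  τ : ℕ
  τ = 2 + t * k

  iterate-closed : ∀ s {v} → v ∈ vs → iterate p s v ∈ vs
  iterate-closed zero    v∈ = v∈
  iterate-closed (suc s) v∈ = iterate-closed s (p-closed v∈)

  lev-iterate : ∀ m {v j} → lev v ≡ m + j → m + j ≤ i → lev (iterate p m v) ≡ j
  lev-iterate zero    eq le = eq
  lev-iterate (suc m) eq le = lev-iterate m (proj₂ (parent eq le)) (≤-trans (n≤1+n _) le)

  module _ (j : ℕ) where

    -- The ancestor at depth j + 1: below a common ancestor at depth j, vertices
    -- in different branches have disjoint paths to that ancestor.
    branch : V → V
    branch v = iterate p (lev v ∸ suc j) v

    branch-p : ∀ {v m} → lev v ≡ suc (m + suc j) → suc (m + suc j) ≤ i → branch (p v) ≡ branch v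
    branch-p {v} {m} eq le
      rewrite eq | proj₂ (parent eq le)
            | m+n∸n≡m m (suc j) | m+n∸n≡m (suc m) (suc j) = refl

    -- The tree path from `v` stays in the branch of `v` and moves to strictly smaller levels. It
    -- therefore avoids `U` as soon as the vertices of `U` in this branch have level at least
    -- `lev v`, and this condition passes on to `p v` and `p v ∷ U`.
    climb : ∀ {a} m {U v} → lev v ≡ m + suc j → m + suc j ≤ i → iterate p (suc m) v ≡ a →
            (∀ {u} → u ∈ U → branch u ≡ branch v → lev v ≤ lev u) → Leg h a U v m
    climb zero    {v = v} lv le refl above = end (proj₁ (parent lv le))
    climb (suc m) {U} {v} lv le eq above =
      step (proj₁ (parent lv le)) new
           (climb m lp (≤-trans (n≤1+n _) le) eq above′)
      where
      lp = proj₂ (parent lv le)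
      lower : lev (p v) < lev v
      lower = ≤-reflexive (trans (cong suc lp) (sym lv))
      bp : branch (p v) ≡ branch v
      bp = branch-p lv le
      new : p v ∉ U
      new pv∈ = <⇒≱ lower (above pv∈ bp)
      above′ : ∀ {u} → u ∈ p v ∷ U → branch u ≡ branch (p v) → lev (p v) ≤ lev u
      above′ (here refl) _  = ≤-refl
      above′ (there u∈)  eq = ≤-trans (<⇒≤ lower) (above u∈ (trans eq bp))

  -- One step of the induction: for each `y` the `F`-neighbours of `y` in level `i` share their
  -- ancestor at depth `j`, and the aim is to pass to edges for which they share the one at depth
  -- `j + 1`.
  module Inductive (s j : ℕ) (s+j≡i : suc s + j ≡ i) (F : V → V → Bool) (good : Good F)
    (common : ∀ {x x′ y} → F x y ≡ true → F x′ y ≡ true →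
              iterate p (suc s) x ≡ iterate p (suc s) x′)
    where

    private
      s+1+j≡i : s + suc j ≡ i
      s+1+j≡i = trans (+-suc s j) s+j≡i

    -- A branch is named by its vertex `b` at depth `j + 1`; this is the number of `F`-neighbours of
    -- `y` in it.
    weight : V → V → ℕ
    weight y b = ∑[ x ∈ vs ] (𝟙 (F x y) * 𝟙 (does (iterate p s x ≟v b)))

    branches : V → ℕ
    branches y = ∑[ b ∈ vs ] 𝟙 (does (0 <? weight y b))

    spread : V → Bool
    spread y = does (τ <? branches y)

    F₁ : V → V → Bool
    F₁ x y = F x y ∧ spread y

    K : V → V → Bool
    K u v = F₁ u v ∨ F₁ v u

    K-sym : ∀ u v → K u v ≡ K v u
    K-sym u v = ∨-comm (F₁ u v) (F₁ v u)

    K-cases : ∀ {u v} → K u v ≡ true → F₁ u v ≡ true ⊎ F₁ v u ≡ true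
    K-cases {u} {v} e with F₁ u v
    ... | true  = inj₁ refl
    ... | false = inj₂ e

    F₁⇒F : ∀ {u v} → F₁ u v ≡ true → F u v ≡ true
    F₁⇒F e = proj₁ (∧-true e)

    K⇒h : ∀ {u v} → K u v ≡ true → h u v ≡ true
    K⇒h {u} {v} e with K-cases e
    ... | inj₁ f = proj₂ (proj₂ (good (F₁⇒F f)))
    ... | inj₂ f = trans (h-sym u v) (proj₂ (proj₂ (good (F₁⇒F f))))

    new-branch : ∀ {y} → spread y ≡ true → ∀ U → length U ≤ τ →
                 ∃ λ x → F x y ≡ true × iterate p s x ∉ U
    new-branch {y} sp U le
      with choose-outside _≟v_ uniq (λ b → does (0 <? weight y b)) U
             (≤-<-trans le (does-true (τ <? branches y) sp))
    ... | b , _ , pos , b∉ with ∑-pos vs _ (does-true (0 <? weight y b) pos)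
    ...   | x , _ , pos′ with F x y in eq | iterate p s x ≟v b
    ...     | true | yes refl = x , eq , b∉

    -- The vertex `a` becomes the sink. The legs wander inside `C`, where degrees exceed every
    -- forbidden list, before they descend to `a` through fresh branches.
    module Growth (a : V) (lev-a : lev a ≡ j) (C : List V) (C-unique : Unique C)
      (C-degree : ∀ {v} → v ∈ C → τ < degree-in K C v) where

      even : ℕ → Bool
      even zero    = true
      even (suc ℓ) = not (even ℓ)

      -- `target (even ℓ)` is the level where a walk between the two levels has to be in order to
      -- reach level `i + 1` after `ℓ` more steps.
      target : Bool → ℕ
      target true  = suc i
      target false = i

      -- A vertex of level `i` is tied to `a` by its own ancestor, one of level `i + 1` by the
      -- ancestor of its `F`-neighbours, which `common` makes unique. In this form the property
      -- spreads along the edges of `K`.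
      record Rooted (w : V) : Set where
        field
          lower : lev w ≡ i → iterate p (suc s) w ≡ a
          upper : ∀ {x} → F x w ≡ true → iterate p (suc s) x ≡ a

      rooted-F : ∀ {u v} → F u v ≡ true → iterate p (suc s) u ≡ a → Rooted u × Rooted v
      rooted-F {u} {v} f eq =
        record { lower = λ _ → eq
               ; upper = λ f′ → contradiction (trans (sym (proj₁ (proj₂ (good f′)))) (proj₁ (good f))) 1+n≢n } ,
        record { lower = λ l → contradiction (trans (sym (proj₁ (proj₂ (good f)))) l) 1+n≢n
               ; upper = λ f′ → trans (common f′ f) eq }

      rooted-K : ∀ {u v} → K u v ≡ true → Rooted u → Rooted v
      rooted-K {u} {v} e r with K-cases e
      ... | inj₁ f = proj₂ (rooted-F (F₁⇒F f) (Rooted.lower r (proj₁ (good (F₁⇒F f)))))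
      ... | inj₂ f = proj₁ (rooted-F (F₁⇒F f) (Rooted.upper r (F₁⇒F f)))

      flip-level : ∀ b {u v} → K u v ≡ true → lev u ≡ target (not b) → lev v ≡ target b
      flip-level true e l with K-cases e
      ... | inj₁ f = proj₁ (proj₂ (good (F₁⇒F f)))
      ... | inj₂ f = contradiction (trans (sym (proj₁ (proj₂ (good (F₁⇒F f))))) l) 1+n≢n
      flip-level false e l with K-cases e
      ... | inj₁ f = contradiction (trans (sym l) (proj₁ (good (F₁⇒F f)))) 1+n≢n
      ... | inj₂ f = proj₁ (good (F₁⇒F f))

      neighbour : ∀ {w} → w ∈ C → ∀ U → length U ≤ τ → ∃ λ v → v ∈ C × K w v ≡ true × v ∉ U
      neighbour {w} w∈ U le = choose-outside _≟v_ C-unique (K w) U (≤-<-trans le (C-degree w∈))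

      spread-top : ∀ {w} → w ∈ C → lev w ≡ suc i → spread w ≡ true
      spread-top w∈ l with neighbour w∈ [] z≤n
      ... | v , _ , e , _ with K-cases e
      ...   | inj₁ f = contradiction (trans (sym l) (proj₁ (good (F₁⇒F f)))) 1+n≢n
      ...   | inj₂ f = proj₂ (∧-true f)

      -- The leg goes from `w` to `x` and from there along the tree to `a`. No vertex of `U` lies in
      -- the branch of `x`, so the climb cannot meet `U`.
      finish : ∀ {x w} U → F x w ≡ true → Rooted w → iterate p s x ∉ map (branch j) U →
               Leg h a U w (suc s)
      finish {x} {w} U f r x∉ = step (trans (h-sym w x) (proj₂ (proj₂ (good f)))) new
        (climb j s lx (≤-reflexive s+1+j≡i) (Rooted.upper r f) above)
        where
        lx : lev x ≡ s + suc j
        lx = trans (proj₁ (good f)) (sym s+1+j≡i)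
        bx : branch j x ≡ iterate p s x
        bx = cong (λ m → iterate p m x) (trans (cong (_∸ suc j) lx) (m+n∸n≡m s (suc j)))
        different : ∀ {u} → u ∈ U → branch j u ≢ branch j x
        different u∈ eq = x∉ (subst (_∈ map (branch j) U) (trans eq bx) (∈-map⁺ (branch j) u∈))
        new : x ∉ U
        new x∈ = different x∈ refl
        above : ∀ {u} → u ∈ x ∷ U → branch j u ≡ branch j x → lev x ≤ lev u
        above (here refl) _  = ≤-refl
        above (there u∈)  eq = contradiction eq (different u∈)

      -- First `ℓ` greedy steps inside `C`; these end at level `i + 1`, in a spread vertex, from
      -- which `finish` takes over. The forbidden list never exceeds `τ`, so both a neighbour and a
      -- branch outside it are available.
      grow : ∀ ℓ {w} U → w ∈ C → lev w ≡ target (even ℓ) → Rooted w → ℓ + length U ≤ τ →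
             Leg h a U w (ℓ + suc s)
      grow (suc ℓ) {w} U w∈ l r le =
        let v , v∈ , e , v∉ = neighbour w∈ U (≤-trans (m≤n+m (length U) (suc ℓ)) le) in
        step (K⇒h e) v∉
          (grow ℓ (v ∷ U) v∈ (flip-level (even ℓ) e l) (rooted-K e r)
                (≤-trans (≤-reflexive (+-suc ℓ (length U))) le))
      grow zero U w∈ l r le =
        let x , f , x∉ = new-branch (spread-top w∈ l) (map (branch j) U)
                           (≤-trans (≤-reflexive (length-map (branch j) U)) le) in
        finish U f r x∉

      -- The number of wandering steps prescribes the level of the common start of all legs; if `r`
      -- is on the other level, a neighbour replaces it.
      start : ∀ {r} → r ∈ C → Rooted r → ∀ b → (lev r ≡ target b ⊎ lev r ≡ target (not b)) →
              ∃ λ w → w ∈ C × Rooted w × lev w ≡ target b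
      start {r} r∈ R b (inj₁ l) = r , r∈ , R , l
      start {r} r∈ R b (inj₂ l) with neighbour r∈ [] z≤n
      ... | w , w∈ , e , _ = w , w∈ , rooted-K e R , flip-level b e l

      theta : ∀ {r} → r ∈ C → Rooted r → ∀ b → lev r ≡ target b → Θ-in h k t
      theta {r} r∈ R b l with start r∈ R (even (k ∸ 1 ∸ suc s)) (cases b (even (k ∸ 1 ∸ suc s)) l)
        where
        cases : ∀ b c → lev r ≡ target b → lev r ≡ target c ⊎ lev r ≡ target (not c)
        cases true  true  l = inj₁ l
        cases true  false l = inj₂ l
        cases false true  l = inj₂ l
        cases false false l = inj₁ l
      ... | w , w∈ , Rw , lw = legs⇒Θ h a w≢a
        (build-legs h a (λ U le → subst (Leg h a U w) ℓ+s≡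
            (grow ℓ U w∈ lw Rw
              (≤-trans (≤-reflexive (+-comm ℓ (length U)))
                       (≤-trans (+-monoʳ-≤ (length U) (m∸n≤m (k ∸ 1) (suc s))) le))))
          t (w ∷ a ∷ []) (+-monoʳ-≤ 2 (*-monoʳ-≤ t (m∸n≤m k 1))))
        where
        -- Of the `k ∸ 1` inner vertices of a leg, `suc s` belong to the final descent to `a`.
        ℓ = k ∸ 1 ∸ suc s
        s≤ : suc s ≤ k ∸ 1
        s≤ = ≤-trans (≤-trans (m≤m+n (suc s) j) (≤-reflexive s+j≡i)) (∸-monoˡ-≤ 1 i<k)
        ℓ+s≡ : ℓ + suc s ≡ k ∸ 1
        ℓ+s≡ = m∸n+n≡m s≤
        j<i : j < i
        j<i = ≤-trans (s≤s (m≤n+m j s)) (≤-reflexive s+j≡i)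
        top : ∀ b → i ≤ target b
        top true  = n≤1+n i
        top false = ≤-refl
        w≢a : w ≢ a
        w≢a refl = <⇒≱ j<i (≤-trans (top (even ℓ)) (≤-reflexive (trans (sym lw) lev-a)))

    -- Any edge of `K` at a vertex of `C` determines `a`: it is the ancestor at depth `j` of the end
    -- in level `i`.
    rooted-theta : ∀ {C} → Unique C → (∀ {v} → v ∈ C → τ < degree-in K C v) →
                   ∀ {r v} → r ∈ C → K r v ≡ true → Θ-in h k t
    rooted-theta {C} C-unique C-degree {r} {v} r∈ e = by-cases (K-cases e)
      where
      lev-a : ∀ {u w} → F u w ≡ true → lev (iterate p (suc s) u) ≡ j
      lev-a f = lev-iterate (suc s) (trans (proj₁ (good f)) (sym s+j≡i)) (≤-reflexive s+j≡i)
      by-cases : F₁ r v ≡ true ⊎ F₁ v r ≡ true → Θ-in h k t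
      by-cases (inj₁ f) = theta r∈ (proj₁ (rooted-F f′ refl)) false (proj₁ (good f′))
        where
        f′ = F₁⇒F f
        open Growth (iterate p (suc s) r) (lev-a f′) C C-unique C-degree
      by-cases (inj₂ f) = theta r∈ (proj₂ (rooted-F f′ refl)) true (proj₁ (proj₂ (good f′)))
        where
        f′ = F₁⇒F f
        open Growth (iterate p (suc s) v) (lev-a f′) C C-unique C-degree

    core-theta : ∀ {S} → Core K τ S → Θ-in h k t
    core-theta c =
      let v , _ , e , _ = choose-outside _≟v_ unique (K root) [] (≤-<-trans z≤n (min-degree root∈vs)) in
      rooted-theta unique min-degree root∈vs e
      where open Core c

    on-levels : V → Bool
    on-levels v = does (lev v ≟ i) ∨ does (lev v ≟ suc i)

    -- With more edges, `K` on the two levels would have a subgraph of minimum degree above `τ`, and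
    -- this contains a theta.
    spread-bound : ¬ Θ-in h k t →
      (∑[ x ∈ vs ] ∑[ y ∈ vs ] 𝟙 (F₁ x y)) ≤ 2 * τ * (size vs lev i + size vs lev (suc i))
    spread-bound Θ-free = begin
      (∑[ x ∈ vs ] ∑[ y ∈ vs ] 𝟙 (F₁ x y))
        ≤⟨ ∑-mono vs (λ x → ∑-mono vs λ y → restrict x y) ⟩
      (∑[ x ∈ vs ] ∑[ y ∈ vs ] (𝟙 (on-levels x) * (𝟙 (on-levels y) * 𝟙 (K x y))))
        ≡⟨ ∑-cong vs (λ x → trans (∑-*ˡ vs (𝟙 (on-levels x)) (λ y → 𝟙 (on-levels y) * 𝟙 (K x y)))
                                 (cong (𝟙 (on-levels x) *_) (sym (∑-filter on-levels vs _)))) ⟩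
      (∑[ x ∈ vs ] (𝟙 (on-levels x) * degree-in K S x))
        ≡⟨ ∑-filter on-levels vs _ ⟨
      ∑ S (degree-in K S)
        ≤⟨ ≮⇒≥ (λ lt → Θ-free (core-theta (core K K-sym τ S (Unique.filter⁺ _ uniq) lt))) ⟩
      2 * τ * length S
        ≤⟨ *-monoʳ-≤ (2 * τ) length-S ⟩
      2 * τ * (size vs lev i + size vs lev (suc i)) ∎
      where
      open ≤-Reasoning
      S : List V
      S = filter (λ v → on-levels v ≟ᵇ true) vs
      𝟙-∨ : ∀ b c → 𝟙 (b ∨ c) ≤ 𝟙 b + 𝟙 c
      𝟙-∨ true  c = s≤s z≤n
      𝟙-∨ false c = ≤-refl
      length-S : length S ≤ size vs lev i + size vs lev (suc i)
      length-S = begin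
        length S                          ≡⟨ length-filter≡∑ on-levels vs ⟩
        (∑[ v ∈ vs ] 𝟙 (on-levels v))     ≤⟨ ∑-mono vs (λ v → 𝟙-∨ (does (lev v ≟ i)) _) ⟩
        _                                 ≡⟨ ∑-+ vs _ _ ⟩
        size vs lev i + size vs lev (suc i) ∎
      on-level-i : ∀ {x} → lev x ≡ i → on-levels x ≡ true
      on-level-i eq rewrite ≟-refl eq = refl
      on-level-i+1 : ∀ {y} → lev y ≡ suc i → on-levels y ≡ true
      on-level-i+1 {y} eq rewrite ≟-refl eq = ∨-zeroʳ (does (lev y ≟ i))
      restrict : ∀ x y → 𝟙 (F₁ x y) ≤ 𝟙 (on-levels x) * (𝟙 (on-levels y) * 𝟙 (K x y))
      restrict x y with F₁ x y in eq
      ... | false = z≤n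
      ... | true rewrite on-level-i (proj₁ (good (F₁⇒F eq)))
                       | on-level-i+1 (proj₁ (proj₂ (good (F₁⇒F eq)))) = ≤-refl

    best : V → V
    best y = argmax (weight y) y vs

    F₂ : V → V → Bool
    F₂ x y = (F x y ∧ not (spread y)) ∧ does (iterate p s x ≟v best y)

    total-weight : ∀ y → (∑[ x ∈ vs ] 𝟙 (F x y)) ≡ ∑ vs (weight y)
    total-weight y = sym (begin
      (∑[ b ∈ vs ] ∑[ x ∈ vs ] (𝟙 (F x y) * 𝟙 (does (iterate p s x ≟v b))))
        ≡⟨ ∑-comm vs vs _ ⟩
      (∑[ x ∈ vs ] ∑[ b ∈ vs ] (𝟙 (F x y) * 𝟙 (does (iterate p s x ≟v b))))
        ≡⟨ ∑-cong-∈ vs (λ {x} x∈ →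
             trans (∑-*ˡ vs (𝟙 (F x y)) (λ b → 𝟙 (does (iterate p s x ≟v b))))
                   (trans (cong (𝟙 (F x y) *_) (one x∈)) (*-identityʳ _))) ⟩
      (∑[ x ∈ vs ] 𝟙 (F x y)) ∎)
      where
      open ≡-Reasoning
      flip-≟ : ∀ u v → does (u ≟v v) ≡ does (v ≟v u)
      flip-≟ u v with v ≟v u
      ... | yes refl = dec-true (u ≟v u) refl
      ... | no v≢u   = dec-false (u ≟v v) (v≢u ∘ sym)
      one : ∀ {x} → x ∈ vs → (∑[ b ∈ vs ] 𝟙 (does (iterate p s x ≟v b))) ≡ 1
      one x∈ = trans (∑-cong vs λ b → cong 𝟙 (flip-≟ _ b)) (∑-≟-≡ _≟v_ uniq (iterate-closed s x∈))

    -- A vertex that is not spread meets at most `τ` branches, so its heaviest branch carries at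
    -- least the fraction `1/τ` of its edges.
    heavy-branch : ∀ y → (∑[ x ∈ vs ] 𝟙 (F x y ∧ not (spread y))) ≤ τ * (∑[ x ∈ vs ] 𝟙 (F₂ x y))
    heavy-branch y with spread y in eq
    ... | true = ≤-trans (≤-reflexive (trans (∑-cong vs λ x → cong 𝟙 (∧-zeroʳ (F x y))) (∑-zero vs))) z≤n
    ... | false = begin
      (∑[ x ∈ vs ] 𝟙 (F x y ∧ true))      ≡⟨ ∑-cong vs (λ x → cong 𝟙 (∧-identityʳ (F x y))) ⟩
      (∑[ x ∈ vs ] 𝟙 (F x y))             ≡⟨ total-weight y ⟩
      ∑ vs (weight y)                     ≤⟨ ∑-≤-support*max vs (weight y) y ⟩
      branches y * weight y (best y)      ≤⟨ *-monoˡ-≤ _ (≮⇒≥ (does-false (τ <? branches y) eq)) ⟩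
      τ * weight y (best y)               ≡⟨ cong (τ *_) (∑-cong vs same) ⟩
      τ * (∑[ x ∈ vs ] 𝟙 ((F x y ∧ true) ∧ does (iterate p s x ≟v best y))) ∎
      where
      open ≤-Reasoning
      same : ∀ x → 𝟙 (F x y) * 𝟙 (does (iterate p s x ≟v best y)) ≡
                   𝟙 ((F x y ∧ true) ∧ does (iterate p s x ≟v best y))
      same x = sym (trans (𝟙-∧ (F x y ∧ true) _)
        (cong (λ b → 𝟙 b * 𝟙 (does (iterate p s x ≟v best y))) (∧-identityʳ (F x y))))

    F₂⇒F : ∀ {x y} → F₂ x y ≡ true → F x y ≡ true
    F₂⇒F = proj₁ ∘ ∧-true ∘ proj₁ ∘ ∧-true

    F₂-common : ∀ {x x′ y} → F₂ x y ≡ true → F₂ x′ y ≡ true → iterate p s x ≡ iterate p s x′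
    F₂-common {x} {x′} {y} e e′ = trans (does-true (iterate p s x ≟v best y) (proj₂ (∧-true e)))
                                   (sym (does-true (iterate p s x′ ≟v best y) (proj₂ (∧-true e′))))

    split-bound : ¬ Θ-in h k t → ∀ {c} →
      (∑[ x ∈ vs ] ∑[ y ∈ vs ] 𝟙 (F₂ x y)) ≤ c * (size vs lev i + size vs lev (suc i)) →
      (∑[ x ∈ vs ] ∑[ y ∈ vs ] 𝟙 (F x y)) ≤
      (2 * τ + τ * c) * (size vs lev i + size vs lev (suc i))
    split-bound Θ-free {c} IH = begin
      (∑[ x ∈ vs ] ∑[ y ∈ vs ] 𝟙 (F x y))
        ≤⟨ ∑-mono vs (λ x → ∑-mono vs λ y → cut (F x y) (spread y)) ⟩
      (∑[ x ∈ vs ] ∑[ y ∈ vs ] (𝟙 (F₁ x y) + 𝟙 (F x y ∧ not (spread y))))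
        ≡⟨ trans (∑-cong vs λ x → ∑-+ vs _ _) (∑-+ vs _ _) ⟩
      (∑[ x ∈ vs ] ∑[ y ∈ vs ] 𝟙 (F₁ x y)) + (∑[ x ∈ vs ] ∑[ y ∈ vs ] 𝟙 (F x y ∧ not (spread y)))
        ≤⟨ +-mono-≤ (spread-bound Θ-free) rest ⟩
      2 * τ * N + τ * (c * N)
        ≡⟨ arr τ c N ⟩
      (2 * τ + τ * c) * N ∎
      where
      open ≤-Reasoning
      N = size vs lev i + size vs lev (suc i)
      arr : ∀ τ c N → 2 * τ * N + τ * (c * N) ≡ (2 * τ + τ * c) * N
      arr = solve-∀
      cut : ∀ b c → 𝟙 b ≤ 𝟙 (b ∧ c) + 𝟙 (b ∧ not c)
      cut true  true  = ≤-refl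
      cut true  false = ≤-refl
      cut false c     = z≤n
      rest : (∑[ x ∈ vs ] ∑[ y ∈ vs ] 𝟙 (F x y ∧ not (spread y))) ≤ τ * (c * N)
      rest = begin
        (∑[ x ∈ vs ] ∑[ y ∈ vs ] 𝟙 (F x y ∧ not (spread y)))  ≡⟨ ∑-comm vs vs _ ⟩
        (∑[ y ∈ vs ] ∑[ x ∈ vs ] 𝟙 (F x y ∧ not (spread y)))  ≤⟨ ∑-mono vs heavy-branch ⟩
        (∑[ y ∈ vs ] (τ * ∑ vs (λ x → 𝟙 (F₂ x y))))           ≡⟨ ∑-*ˡ vs τ _ ⟩
        τ * (∑[ y ∈ vs ] ∑[ x ∈ vs ] 𝟙 (F₂ x y))              ≡⟨ cong (τ *_) (∑-comm vs vs _) ⟩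
        τ * (∑[ x ∈ vs ] ∑[ y ∈ vs ] 𝟙 (F₂ x y))              ≤⟨ *-monoʳ-≤ τ IH ⟩
        τ * (c * N)                                           ∎

  -- Induction on the distance `s` from level `i` to the common ancestors. At distance 0 the
  -- neighbours of `y` in level `i` coincide, so each vertex of level `i + 1` has at most one edge.
  level-edges : ¬ Θ-in h k t → ∀ s j → s + j ≡ i → ∀ F → Good F →
    (∀ {x x′ y} → F x y ≡ true → F x′ y ≡ true → iterate p s x ≡ iterate p s x′) →
    (∑[ x ∈ vs ] ∑[ y ∈ vs ] 𝟙 (F x y)) ≤ level-bound τ s * (size vs lev i + size vs lev (suc i))
  level-edges Θ-free (suc s) j eq F good common =
    split-bound Θ-free {level-bound τ s}
      (level-edges Θ-free s (suc j) (trans (+-suc s j) eq) F₂ (good ∘ F₂⇒F) F₂-common)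
    where open Inductive s j eq F good common
  level-edges Θ-free zero j eq F good common = begin
    (∑[ x ∈ vs ] ∑[ y ∈ vs ] 𝟙 (F x y))      ≡⟨ ∑-comm vs vs _ ⟩
    (∑[ y ∈ vs ] ∑[ x ∈ vs ] 𝟙 (F x y))      ≤⟨ ∑-mono vs one ⟩
    size vs lev (suc i)                      ≤⟨ m≤n+m _ (size vs lev i) ⟩
    size vs lev i + size vs lev (suc i)      ≡⟨ *-identityˡ _ ⟨
    1 * (size vs lev i + size vs lev (suc i)) ∎
    where
    open ≤-Reasoning
    one : ∀ y → (∑[ x ∈ vs ] 𝟙 (F x y)) ≤ 𝟙 (does (lev y ≟ suc i))
    one y with does (lev y ≟ suc i) in eq
    ... | true  = ∑-at-most-one _≟v_ uniq (λ x → F x y) common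
    ... | false = ≤-reflexive (trans (∑-cong vs off) (∑-zero vs))
      where
      off : ∀ x → 𝟙 (F x y) ≡ 0
      off x with F x y in e
      ... | true  = contradiction (proj₁ (proj₂ (good e))) (does-false (lev y ≟ suc i) eq)
      ... | false = refl

-- Theta-free bipartite graphs have few edges

-- Bounded search: the value `f` signals that `P` holds nowhere below `f`.
least : (ℕ → Bool) → ℕ → ℕ
least P zero    = 0
least P (suc f) = if P 0 then 0 else suc (least (P ∘ suc) f)

least-sat : ∀ P f {m} → least P f ≡ m → m < f → P m ≡ true
least-sat P (suc f) {m} eq lt with P 0 in P0
least-sat P (suc f) refl lt       | true  = P0
least-sat P (suc f) refl (s≤s lt) | false = least-sat (P ∘ suc) f refl lt

least-≤ : ∀ P f {m} → P m ≡ true → least P f ≤ m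
least-≤ P zero    Pm = z≤n
least-≤ P (suc f) {m} Pm with P 0 in P0
... | true  = z≤n
least-≤ P (suc f) {zero}  Pm | false = contradiction (trans (sym P0) Pm) λ ()
least-≤ P (suc f) {suc m} Pm | false = s≤s (least-≤ (P ∘ suc) f Pm)

level-bound-mono : ∀ {τ} → 1 ≤ τ → ∀ {s s′} → s ≤′ s′ → level-bound τ s ≤ level-bound τ s′
level-bound-mono         1≤τ ≤′-refl       = ≤-refl
level-bound-mono {suc τ} 1≤τ (≤′-step {n} le) =
  ≤-trans (level-bound-mono 1≤τ le)
    (≤-trans (m≤m+n (level-bound (suc τ) n) (τ * level-bound (suc τ) n)) (m≤n+m _ (2 * suc τ)))

alternate : ℕ → Bool → Bool
alternate zero    b = b
alternate (suc m) b = not (alternate m b)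

module BFS {V : Set} (_≟v_ : DecidableEquality V)
  (h : V → V → Bool) (h-sym : ∀ u v → h u v ≡ h v u)
  (colour : V → Bool) (proper : ∀ {u v} → h u v ≡ true → colour v ≡ not (colour u))
  (vs : List V) (uniq : Unique vs) (root : V) (root∈ : root ∈ vs) (k t : ℕ)
  where

  walk : ℕ → V → Bool
  walk zero    v = does (v ≟v root)
  walk (suc m) v = does (Any.any? (λ u → (walk m u ∧ h u v) ≟ᵇ true) vs)

  walk-suc : ∀ {m u v} → u ∈ vs → walk m u ≡ true → h u v ≡ true → walk (suc m) v ≡ true
  walk-suc {m} {u} {v} u∈ w e =
    dec-true (Any.any? (λ u → (walk m u ∧ h u v) ≟ᵇ true) vs)
             (Any.map (λ { refl → cong₂ _∧_ w e }) u∈)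

  walk-pred : ∀ {m v} → walk (suc m) v ≡ true → ∃ λ u → u ∈ vs × walk m u ≡ true × h u v ≡ true
  walk-pred {m} {v} w =
    let u , u∈ , e = find (does-true (Any.any? (λ u → (walk m u ∧ h u v) ≟ᵇ true) vs) w) in
    u , u∈ , ∧-true e

  walk-colour : ∀ m {v} → walk m v ≡ true → colour v ≡ alternate m (colour root)
  walk-colour zero {v} w = cong colour (does-true (v ≟v root) w)
  walk-colour (suc m) w =
    let u , _ , w′ , e = walk-pred {m} w in
    trans (proper e) (cong not (walk-colour m w′))

  -- Values up to `k` are lengths of shortest walks from the root; `suc k` stands for everything
  -- farther away or unreachable.
  lev : V → ℕ
  lev v = least (λ m → walk m v) (suc k)

  lev-walk : ∀ {v m} → lev v ≡ m → m ≤ k → walk m v ≡ true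
  lev-walk {v} eq le = least-sat (λ m → walk m v) (suc k) eq (s≤s le)

  lev-≤ : ∀ {v} m → walk m v ≡ true → lev v ≤ m
  lev-≤ {v} m w = least-≤ (λ m → walk m v) (suc k) w

  lev-step : ∀ {u v} → u ∈ vs → lev u ≤ k → h u v ≡ true → lev v ≤ suc (lev u)
  lev-step {u} {v} u∈ le e = lev-≤ (suc (lev u)) (walk-suc {lev u} u∈ (lev-walk refl le) e)

  lev-pred : ∀ {v m} → lev v ≡ suc m → suc m ≤ k →
             ∃ λ u → u ∈ vs × h u v ≡ true × suc (lev u) ≡ lev v
  lev-pred {v} {m} eq le =
    let u , u∈ , w , e = walk-pred {m} (lev-walk eq le)
        lu≤m = lev-≤ m w
    in u , u∈ , e , ≤-antisym (≤-trans (s≤s lu≤m) (≤-reflexive (sym eq)))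
                              (lev-step u∈ (≤-trans lu≤m (≤-trans (n≤1+n m) le)) e)

  lev-root : lev root ≡ 0
  lev-root = n≤0⇒n≡0 (lev-≤ 0 (dec-true (root ≟v root) refl))

  lev-0 : ∀ {v} → lev v ≡ 0 → v ≡ root
  lev-0 {v} eq = does-true (v ≟v root) (lev-walk eq z≤n)

  -- Colours alternate along walks from the root, so vertices of equal level have equal colour.
  lev-≢ : ∀ {u v} → lev u ≤ k → h u v ≡ true → lev u ≢ lev v
  lev-≢ {u} {v} le e eq = not-≢ (colour u) (trans (sym (proper e)) (trans
    (walk-colour (lev u) (lev-walk (sym eq) le)) (sym (walk-colour (lev u) (lev-walk refl le)))))

  is-parent : V → V → Bool
  is-parent v u = h u v ∧ does (suc (lev u) ≟ lev v)

  -- A vertex without a neighbour in the previous level, such as the root, becomes its own parent.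
  choose : ∀ v → Dec (Any (λ u → is-parent v u ≡ true) vs) → V
  choose v (yes a) = proj₁ (find a)
  choose v (no _)  = v

  parent : V → V
  parent v = choose v (Any.any? (λ u → is-parent v u ≟ᵇ true) vs)

  parent-closed : ∀ {v} → v ∈ vs → parent v ∈ vs
  parent-closed {v} v∈ with Any.any? (λ u → is-parent v u ≟ᵇ true) vs
  ... | yes a = proj₁ (proj₂ (find a))
  ... | no _  = v∈

  is-parent-parent : ∀ {v m} → lev v ≡ suc m → suc m ≤ k → is-parent v (parent v) ≡ true
  is-parent-parent {v} eq le with Any.any? (λ u → is-parent v u ≟ᵇ true) vs
  ... | yes a = proj₂ (proj₂ (find a))
  ... | no ¬a =
    let u , u∈ , e , l = lev-pred eq le in
    contradiction (Any.map (λ { refl → cong₂ _∧_ e (≟-refl l) }) u∈) ¬a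

  parent-spec : ∀ {v m} → lev v ≡ suc m → suc m ≤ k → h v (parent v) ≡ true × lev (parent v) ≡ m
  parent-spec {v} eq le =
    let e , l = ∧-true (is-parent-parent eq le) in
    trans (h-sym v (parent v)) e ,
    suc-injective (trans (does-true (suc (lev (parent v)) ≟ lev v) l) eq)

  down : ℕ → V → V → Bool
  down m u v = does (lev u ≟ m) ∧ (does (lev v ≟ suc m) ∧ h u v)

  down-spec : ∀ {m u v} → down m u v ≡ true → lev u ≡ m × lev v ≡ suc m × h u v ≡ true
  down-spec {m} {u} {v} e =
    let a , bc = ∧-true e
        b , c = ∧-true bc
    in does-true (lev u ≟ m) a , does-true (lev v ≟ suc m) b , c

  down-true : ∀ {m u v} → lev u ≡ m → lev v ≡ suc m → h u v ≡ true → down m u v ≡ true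
  down-true a b c = cong₂ _∧_ (≟-refl a) (cong₂ _∧_ (≟-refl b) c)

  edges : ℕ → ℕ
  edges m = ∑[ u ∈ vs ] ∑[ v ∈ vs ] 𝟙 (down m u v)

  n[_] : ℕ → ℕ
  n[ m ] = size vs lev m

  module _ (Θ-free : ¬ Θ-in h k t) where

    private
      τ c : ℕ
      τ = 2 + t * k
      c = level-bound τ k

    -- All vertices of level `i` have the root as their ancestor at depth 0, so `level-edges`
    -- applies with `s = i`; monotonicity of `level-bound` makes the constant uniform.
    edges-≤ : ∀ {i} → i < k → edges i ≤ c * (n[ i ] + n[ suc i ])
    edges-≤ {i} i<k = ≤-trans
      (level-edges Θ-free i 0 (+-identityʳ i) (down i) down-spec
        (λ f f′ → trans (to-root f) (sym (to-root f′))))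
      (*-monoˡ-≤ _ (level-bound-mono {τ} (s≤s z≤n) (≤⇒≤′ (<⇒≤ i<k))))
      where
      open Tree _≟v_ h h-sym vs uniq parent parent-closed lev i
             (λ eq le → parent-spec eq (≤-trans le (<⇒≤ i<k))) k t i<k using (level-edges; lev-iterate)
      to-root : ∀ {x y} → down i x y ≡ true → iterate parent i x ≡ root
      to-root f = lev-0 (lev-iterate i (trans (proj₁ (down-spec f)) (sym (+-identityʳ i)))
                                       (≤-reflexive (+-identityʳ i)))

    up-edges : ℕ → ℕ
    up-edges zero    = 0
    up-edges (suc m) = edges m

    up : ℕ → V → V → Bool
    up zero    u v = false
    up (suc m) u v = down m v u

    -- Levels of adjacent vertices differ by at most one, and by bipartiteness they are not equal.
    degree-split : ∀ {m u v} → m < k → u ∈ vs → v ∈ vs → lev u ≡ m → 𝟙 (h u v) ≤ 𝟙 (down m u v) + 𝟙 (up m u v)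
    degree-split {m} {u} {v} m<k u∈ v∈ lu = 𝟙-≤ edge-case
      where
      edge-case : h u v ≡ true → 1 ≤ 𝟙 (down m u v) + 𝟙 (up m u v)
      edge-case e = by-cases (m≤n⇒m<n∨m≡n lv≤)
        where
        lv≤ : lev v ≤ suc m
        lv≤ = subst (λ l → lev v ≤ suc l) lu (lev-step u∈ (≤-trans (≤-reflexive lu) (<⇒≤ m<k)) e)
        lu≤ : m ≤ suc (lev v)
        lu≤ = subst (_≤ suc (lev v)) lu (lev-step v∈ (≤-trans lv≤ m<k) (trans (h-sym v u) e))
        is-up : ∀ {m} → m ≡ suc (lev v) → lev u ≡ m → up m u v ≡ true
        is-up refl eq = down-true refl eq (trans (h-sym v u) e)
        by-cases : lev v < suc m ⊎ lev v ≡ suc m → 1 ≤ 𝟙 (down m u v) + 𝟙 (up m u v)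
        by-cases (inj₂ eq) = ≤-trans (≤-reflexive (cong 𝟙 (sym (down-true lu eq e)))) (m≤m+n _ _)
        by-cases (inj₁ (s≤s lv≤m)) with m≤n⇒m<n∨m≡n lv≤m
        ... | inj₂ eq = contradiction (trans lu (sym eq)) (lev-≢ (≤-trans (≤-reflexive lu) (<⇒≤ m<k)) e)
        ... | inj₁ lt = ≤-trans (≤-reflexive (cong 𝟙 (sym (is-up (≤-antisym lu≤ lt) lu)))) (m≤n+m _ _)

    module _ {g} (1≤g : 1 ≤ g) (min-degree : ∀ {v} → v ∈ vs → c * (g + 3) ≤ degree-in h vs v) where

      level-degrees : ∀ {m} → m < k → c * (g + 3) * n[ m ] ≤ edges m + up-edges m
      level-degrees {m} m<k = begin
        q * n[ m ]
          ≡⟨ ∑-*ˡ vs q _ ⟨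
        (∑[ u ∈ vs ] (q * 𝟙 (does (lev u ≟ m))))
          ≤⟨ ∑-mono-∈ vs at ⟩
        (∑[ u ∈ vs ] ∑[ v ∈ vs ] (𝟙 (down m u v) + 𝟙 (up m u v)))
          ≡⟨ trans (∑-cong vs (λ u → ∑-+ vs _ _)) (∑-+ vs _ _) ⟩
        edges m + (∑[ u ∈ vs ] ∑[ v ∈ vs ] 𝟙 (up m u v))
          ≡⟨ cong (edges m +_) (up-sum m) ⟩
        edges m + up-edges m ∎
        where
        open ≤-Reasoning
        q = c * (g + 3)
        up-sum : ∀ m → (∑[ u ∈ vs ] ∑[ v ∈ vs ] 𝟙 (up m u v)) ≡ up-edges m
        up-sum zero    = trans (∑-cong vs λ u → ∑-zero vs) (∑-zero vs)
        up-sum (suc m) = ∑-comm vs vs _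
        at : ∀ {u} → u ∈ vs → q * 𝟙 (does (lev u ≟ m)) ≤ (∑[ v ∈ vs ] (𝟙 (down m u v) + 𝟙 (up m u v)))
        at {u} u∈ = *𝟙-≤ λ eq → ≤-trans (min-degree u∈)
          (∑-mono-∈ vs λ v∈ → degree-split m<k u∈ v∈ (does-true (lev u ≟ m) eq))

      private
        1≤c : 1 ≤ c
        1≤c = 1≤level-bound k (s≤s z≤n)

      -- Let `x`, `y` be the sizes of levels `m` and `m + 1`, and `a` a bound for the previous one.
      -- Level `m` has at least `c * (g + 3) * x` edge ends and at most `c * (x + y) + c * (a + x)`;
      -- since `a ≤ x`, the summand 3 absorbs everything but `c * y`.
      grows : ∀ {a} m → m < k → up-edges m ≤ c * (a + n[ m ]) → a ≤ n[ m ] → g * n[ m ] ≤ n[ suc m ]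
      grows {a} m m<k le a≤ = *-cancelˡ-≤ c ⦃ >-nonZero 1≤c ⦄ (+-cancelˡ-≤ (c * (3 * x)) _ _ (begin
        c * (3 * x) + c * (g * x)        ≡⟨ arr c g x ⟩
        c * (g + 3) * x                  ≤⟨ level-degrees m<k ⟩
        edges m + up-edges m             ≤⟨ +-mono-≤ (edges-≤ m<k) (≤-trans le (*-monoʳ-≤ c (+-monoˡ-≤ x a≤))) ⟩
        c * (x + y) + c * (x + x)        ≡⟨ arr′ c x y ⟩
        c * (3 * x) + c * y              ∎))
        where
        open ≤-Reasoning
        x = n[ m ]
        y = n[ suc m ]
        arr : ∀ c g x → c * (3 * x) + c * (g * x) ≡ c * (g + 3) * x
        arr = solve-∀
        arr′ : ∀ c x y → c * (x + y) + c * (x + x) ≡ c * (3 * x) + c * y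
        arr′ = solve-∀

      expansion : ∀ m → m < k → g * n[ m ] ≤ n[ suc m ]
      -- No level precedes the root, hence `a = 0`.
      expansion zero    m<k = grows {0} 0 m<k z≤n z≤n
      expansion (suc m) m<k = grows (suc m) m<k (edges-≤ m<k′)
        (≤-trans (≤-trans (≤-reflexive (sym (*-identityˡ _))) (*-monoˡ-≤ n[ m ] 1≤g)) (expansion m m<k′))
        where m<k′ = ≤-trans (n≤1+n _) m<k

      power-≤ : ∀ m → m ≤ k → g ^ m ≤ n[ m ]
      power-≤ zero    _   = ≤-trans (≤-reflexive (cong 𝟙 (sym (≟-refl lev-root))))
                                    (≤∑ (λ v → 𝟙 (does (lev v ≟ 0))) root∈)
      power-≤ (suc m) m<k = ≤-trans (*-monoʳ-≤ g (power-≤ m (<⇒≤ m<k))) (expansion m m<k)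

      many-vertices : g ^ k ≤ length vs
      many-vertices = ≤-trans (power-≤ k ≤-refl)
        (≤-trans (∑-≤-const vs λ {v} _ → 𝟙≤1 (does (lev v ≟ k))) (≤-reflexive (*-identityʳ _)))

Θ-constant : ℕ → ℕ → ℕ
Θ-constant k t = level-bound (2 + t * k) k

-- Otherwise some subgraph has minimum degree above `Θ-constant k t * (g + 3)`; there the levels
-- grow by the factor `g`, and level `k` alone exceeds `length S`. With `g` just above the `k`-th
-- root of `length S` the bound is of order |S|^(1+1/k).
Θ-free-bound : ∀ {V : Set} (_≟v_ : DecidableEquality V) (h : V → V → Bool) →
  (∀ u v → h u v ≡ h v u) → (colour : V → Bool) → (∀ {u v} → h u v ≡ true → colour v ≡ not (colour u)) →
  ∀ {k t} → ¬ Θ-in h k t → ∀ {S} → Unique S → ∀ {g} → 1 ≤ g → length S < g ^ k →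
  (∑[ v ∈ S ] degree-in h S v) ≤ 2 * (Θ-constant k t * (g + 3)) * length S
Θ-free-bound _≟v_ h h-sym colour proper {k} {t} Θ-free {S} uniq {g} 1≤g lt = ≮⇒≥ λ many →
  let open Core (core h h-sym (Θ-constant k t * (g + 3)) S uniq many)
      open BFS _≟v_ h h-sym colour proper vs unique root root∈vs k t
  in <⇒≱ lt (≤-trans (many-vertices Θ-free 1≤g (λ v∈ → <⇒≤ (min-degree v∈))) length≤)

-- A bipartite subgraph with half of the edges

module _ (_≟v_ : DecidableEquality A) where

  update : A → B → (A → B) → A → B
  update x b f y = if does (y ≟v x) then b else f y

  update-≡ : ∀ x (b : B) f → update x b f x ≡ b
  update-≡ x b f rewrite dec-true (x ≟v x) refl = refl

  update-≢ : ∀ {x xs} → All (x ≢_) xs → ∀ (b : B) f {y} → y ∈ xs → update x b f y ≡ f y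
  update-≢ {x = x} x∉ b f {y} y∈ rewrite dec-false (y ≟v x) (All.lookup x∉ y∈ ∘ sym) = refl

  module _ (w : A → A → ℕ) (w-sym : ∀ u v → w u v ≡ w v u) (w-irrefl : ∀ u → w u u ≡ 0) where

    crossing : (A → Bool) → A → A → ℕ
    crossing c u v = w u v * 𝟙 (c u xor c v)

    -- Greedy colouring: `x` takes the side that cuts at least half of its weight to the vertices
    -- coloured already.
    half-cut : ∀ xs → Unique xs → ∃ λ (c : A → Bool) →
      (∑[ u ∈ xs ] ∑[ v ∈ xs ] w u v) ≤ 2 * (∑[ u ∈ xs ] ∑[ v ∈ xs ] crossing c u v)
    half-cut []       _           = (λ _ → true) , z≤n
    half-cut (x ∷ xs) (x∉ ∷ uniq) = c′ , bound
      where
      open ≤-Reasoning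
      IH = half-cut xs uniq
      c = proj₁ IH
      to : Bool → ℕ
      to b = ∑[ v ∈ xs ] (w x v * 𝟙 (b xor c v))
      D T T′ : ℕ
      D = ∑[ v ∈ xs ] w x v
      T = ∑[ u ∈ xs ] ∑[ v ∈ xs ] w u v
      T′ = ∑[ u ∈ xs ] ∑[ v ∈ xs ] crossing c u v
      split : D ≡ to true + to false
      split = trans (∑-cong xs λ v → one (w x v) (c v)) (∑-+ xs _ _)
        where
        one : ∀ m b → m ≡ m * 𝟙 (true xor b) + m * 𝟙 (false xor b)
        one m true  = sym (trans (cong₂ _+_ (*-zeroʳ m) (*-identityʳ m)) refl)
        one m false = sym (trans (cong₂ _+_ (*-identityʳ m) (*-zeroʳ m)) (+-identityʳ m))
      majority : ∃ λ b → D ≤ to b + to b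
      majority with ≤-total (to true) (to false)
      ... | inj₁ le = false , ≤-trans (≤-reflexive split) (+-monoˡ-≤ _ le)
      ... | inj₂ le = true  , ≤-trans (≤-reflexive split) (+-monoʳ-≤ _ le)
      b = proj₁ majority
      c′ : A → Bool
      c′ = update x b c
      row : (∑[ v ∈ xs ] crossing c′ x v) ≡ to b
      row = ∑-cong-∈ xs λ v∈ → cong (w x _ *_) (cong 𝟙 (cong₂ _xor_ (update-≡ x b c) (update-≢ x∉ b c v∈)))
      column : (∑[ u ∈ xs ] crossing c′ u x) ≡ to b
      column = trans (∑-cong xs λ u → cong₂ _*_ (w-sym u x) (cong 𝟙 (xor-comm (c′ u) (c′ x)))) row
      inside : (∑[ u ∈ xs ] ∑[ v ∈ xs ] crossing c′ u v) ≡ T′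
      inside = ∑-cong-∈ xs λ u∈ → ∑-cong-∈ xs λ v∈ → cong (w _ _ *_)
        (cong 𝟙 (cong₂ _xor_ (update-≢ x∉ b c u∈) (update-≢ x∉ b c v∈)))
      arr : ∀ X T → (X + X) + ((X + X) + 2 * T) ≡ 2 * (X + (X + T))
      arr = solve-∀
      bound : (w x x + D) + (∑[ u ∈ xs ] (w u x + ∑ xs (w u))) ≤
              2 * ((crossing c′ x x + (∑[ v ∈ xs ] crossing c′ x v)) +
                   (∑[ u ∈ xs ] (crossing c′ u x + (∑[ v ∈ xs ] crossing c′ u v))))
      bound = begin
        (w x x + D) + (∑[ u ∈ xs ] (w u x + ∑ xs (w u)))
          ≡⟨ cong₂ _+_ (cong (_+ D) (w-irrefl x)) (trans (∑-+ xs _ _) (cong (_+ T) (∑-cong xs λ u → w-sym u x))) ⟩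
        D + (D + T)
          ≤⟨ +-mono-≤ (proj₂ majority) (+-mono-≤ (proj₂ majority) (proj₂ IH)) ⟩
        (to b + to b) + ((to b + to b) + 2 * T′)
          ≡⟨ arr (to b) T′ ⟩
        2 * (to b + (to b + T′))
          ≡⟨ cong (2 *_) (cong₂ _+_ row (trans (∑-+ xs _ _) (cong₂ _+_ column inside))) ⟨
        2 * ((∑[ v ∈ xs ] crossing c′ x v) +
             (∑[ u ∈ xs ] (crossing c′ u x + (∑[ v ∈ xs ] crossing c′ u v))))
          ≤⟨ *-monoʳ-≤ 2 (+-monoˡ-≤ _ (m≤n+m _ (crossing c′ x x))) ⟩
        _ ∎

  -- Splitting a set into classes of bounded size

  -- The intention is that all classes before the last one are full. The field `top*d≤` keeps what
  -- matters of this: the number `suc top` of classes exceeds the size divided by `d` by at most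
  -- one.
  record Classes (P : A → Bool) (d : ℕ) (xs : List A) : Set where
    field
      label : A → ℕ
      top  : ℕ
      label≤top : ∀ v → label v ≤ top
      top*d≤    : top * d + (∑[ v ∈ xs ] 𝟙 (P v ∧ does (top ≟ label v))) ≤ (∑[ v ∈ xs ] 𝟙 (P v))
      class≤d    : ∀ i → (∑[ v ∈ xs ] 𝟙 (P v ∧ does (i ≟ label v))) ≤ d

  -- A new element joins class `top` while there is room and otherwise opens the class `suc top`,
  -- empty until then.
  classes : ∀ P {d} → 1 ≤ d → ∀ xs → Unique xs → Classes P d xs
  classes P 1≤d []       _ = record
    { label = λ _ → 0 ; top = 0 ; label≤top = λ _ → z≤n ; top*d≤ = z≤n ; class≤d = λ _ → z≤n }
  classes P {d} 1≤d (x ∷ xs) (x∉ ∷ uniq) = cases (P x) refl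
    where
    open Classes (classes P 1≤d xs uniq)
    class : ℕ → ℕ
    class i = ∑[ v ∈ xs ] 𝟙 (P v ∧ does (i ≟ label v))
    N : ℕ
    N = ∑[ v ∈ xs ] 𝟙 (P v)
    relabelled : ∀ m i → (∑[ v ∈ xs ] 𝟙 (P v ∧ does (i ≟ update x m label v))) ≡ class i
    relabelled m i = ∑-cong-∈ xs λ v∈ → cong (λ l → 𝟙 (P _ ∧ does (i ≟ l))) (update-≢ x∉ m label v∈)
    relabelled-≤ : ∀ m {l} → m ≤ l → top ≤ l → ∀ v → update x m label v ≤ l
    relabelled-≤ m m≤ top≤ v with does (v ≟v x)
    ... | true  = m≤
    ... | false = ≤-trans (label≤top v) top≤
    total : ∀ m i → P x ≡ true →
      (∑[ v ∈ x ∷ xs ] 𝟙 (P v ∧ does (i ≟ update x m label v))) ≡ 𝟙 (does (i ≟ m)) + class i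
    total m i Px = cong₂ _+_ (cong 𝟙 (cong₂ _∧_ Px (cong (λ l → does (i ≟ l)) (update-≡ x m label)))) (relabelled m i)
    above : class (suc top) ≡ 0
    above = trans (∑-cong xs off) (∑-zero xs)
      where
      off : ∀ v → 𝟙 (P v ∧ does (suc top ≟ label v)) ≡ 0
      off v rewrite dec-false (suc top ≟ label v) (λ eq → 1+n≰n (subst (_≤ top) (sym eq) (label≤top v)))
        with P v
      ... | true  = refl
      ... | false = refl
    cases : ∀ b → P x ≡ b → Classes P d (x ∷ xs)
    cases false Px = record
      { label = label ; top = top ; label≤top = label≤top
      ; top*d≤ = subst (λ b → top * d + (𝟙 (b ∧ does (top ≟ label x)) + class top) ≤ 𝟙 b + N) (sym Px) top*d≤
      ; class≤d = λ i → subst (λ b → 𝟙 (b ∧ does (i ≟ label x)) + class i ≤ d) (sym Px) (class≤d i) }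
    cases true Px with class top <? d
    ... | yes room = record
      { label = update x top label ; top = top ; label≤top = relabelled-≤ top ≤-refl ≤-refl
      ; top*d≤ = begin
          top * d + _
            ≡⟨ cong (top * d +_)
                 (trans (total top top Px) (cong (λ b → 𝟙 b + class top) (≟-refl {top} refl))) ⟩
          top * d + suc (class top)        ≡⟨ +-suc (top * d) (class top) ⟩
          suc (top * d + class top)        ≤⟨ s≤s top*d≤ ⟩
          suc N                              ≡⟨ cong (λ b → 𝟙 b + N) Px ⟨
          𝟙 (P x) + N                        ∎
      ; class≤d = λ i → ≤-trans (≤-reflexive (total top i Px)) (fits i) }
      where
      open ≤-Reasoning
      fits : ∀ i → 𝟙 (does (i ≟ top)) + class i ≤ d
      fits i with i ≟ top
      ... | yes refl = subst (λ b → 𝟙 b + class i ≤ d) (sym (≟-refl {i} refl)) room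
      ... | no i≢    = subst (λ b → 𝟙 b + class i ≤ d) (sym (dec-false (i ≟ top) i≢)) (class≤d i)
    ... | no full = record
      { label = update x (suc top) label ; top = suc top
      ; label≤top = relabelled-≤ (suc top) ≤-refl (n≤1+n top)
      ; top*d≤ = begin
          suc top * d + _
            ≡⟨ cong (suc top * d +_) (trans (total (suc top) (suc top) Px)
                 (cong₂ (λ b e → 𝟙 b + e) (≟-refl {suc top} refl) above)) ⟩
          (d + top * d) + 1                 ≡⟨ +-comm (d + top * d) 1 ⟩
          suc (d + top * d)                 ≡⟨ cong suc (+-comm d (top * d)) ⟩
          suc (top * d + d)                 ≤⟨ s≤s (+-monoʳ-≤ (top * d) (≮⇒≥ full)) ⟩
          suc (top * d + class top)        ≤⟨ s≤s top*d≤ ⟩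
          suc N                              ≡⟨ cong (λ b → 𝟙 b + N) Px ⟨
          𝟙 (P x) + N                        ∎
      ; class≤d = λ i → ≤-trans (≤-reflexive (total (suc top) i Px)) (fits i) }
      where
      open ≤-Reasoning
      fits : ∀ i → 𝟙 (does (i ≟ suc top)) + class i ≤ d
      fits i with i ≟ suc top
      ... | yes refl = ≤-trans (≤-reflexive (cong₂ (λ b e → 𝟙 b + e) (≟-refl {i} refl) above)) 1≤d
      ... | no i≢    = subst (λ b → 𝟙 b + class i ≤ d) (sym (dec-false (i ≟ suc top) i≢)) (class≤d i)

-- Counting four-cycles

-- The homomorphisms from C₄ are grouped by one edge `r p`, the inner sum being the number of edges
-- between the neighbourhoods of its ends. With at most `T` for each edge, the fourth power of the
-- edge count is at most `length xs ^ 4 * (e * T)`, and one factor `e` cancels.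
cherries-C₄ : ∀ (xs : List A) (b : A → A → ℕ) T →
  (∀ r p → b r p * (∑[ s ∈ xs ] ∑[ q ∈ xs ] (b r q * (b s p * b s q))) ≤ b r p * T) →
  (∑[ p ∈ xs ] ∑[ q ∈ xs ] b p q) ^ 3 ≤ length xs ^ 4 * T
cherries-C₄ xs b T le = cancel e refl
  where
  open ≤-Reasoning
  e = ∑[ p ∈ xs ] ∑[ q ∈ xs ] b p q
  arr : ∀ a b c d → (a * b) * (c * d) ≡ a * (b * (c * d))
  arr = solve-∀
  arr′ : ∀ s e t → s * (e * t) ≡ e * (s * t)
  arr′ = solve-∀
  reorder : (∑[ p ∈ xs ] ∑[ q ∈ xs ] ((∑[ r ∈ xs ] (b r p * b r q)) * (∑[ s ∈ xs ] (b s p * b s q)))) ≡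
            (∑[ r ∈ xs ] ∑[ p ∈ xs ] (b r p * (∑[ s ∈ xs ] ∑[ q ∈ xs ] (b r q * (b s p * b s q)))))
  reorder = begin-equality
    _ ≡⟨ ∑-cong xs (λ p → ∑-cong xs λ q → ∑-*-∑ xs xs (λ r → b r p * b r q) (λ s → b s p * b s q)) ⟩
    (∑[ p ∈ xs ] ∑[ q ∈ xs ] ∑[ r ∈ xs ] ∑[ s ∈ xs ] ((b r p * b r q) * (b s p * b s q)))
      ≡⟨ ∑-cong xs (λ p → trans (∑-comm xs xs _) (∑-cong xs λ r → ∑-comm xs xs _)) ⟩
    (∑[ p ∈ xs ] ∑[ r ∈ xs ] ∑[ s ∈ xs ] ∑[ q ∈ xs ] ((b r p * b r q) * (b s p * b s q)))
      ≡⟨ ∑-comm xs xs _ ⟩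
    (∑[ r ∈ xs ] ∑[ p ∈ xs ] ∑[ s ∈ xs ] ∑[ q ∈ xs ] ((b r p * b r q) * (b s p * b s q)))
      ≡⟨ ∑-cong xs (λ r → ∑-cong xs λ p → trans
           (∑-cong xs λ s → trans (∑-cong xs λ q → arr (b r p) (b r q) (b s p) (b s q))
                                  (∑-*ˡ xs (b r p) (λ q → b r q * (b s p * b s q))))
           (∑-*ˡ xs (b r p) (λ s → ∑[ q ∈ xs ] (b r q * (b s p * b s q))))) ⟩
    _ ∎
  e⁴≤ : e ^ 4 ≤ e * (length xs ^ 4 * T)
  e⁴≤ = begin
    e ^ 4                    ≤⟨ sidorenko-C₄ xs b ⟩
    length xs ^ 4 * _        ≡⟨ cong (length xs ^ 4 *_) reorder ⟩
    length xs ^ 4 * _        ≤⟨ *-monoʳ-≤ (length xs ^ 4) (∑-mono xs λ r → ∑-mono xs λ p → le r p) ⟩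
    length xs ^ 4 * (∑[ r ∈ xs ] ∑[ p ∈ xs ] (b r p * T))
      ≡⟨ cong (length xs ^ 4 *_) (trans (∑-cong xs λ r → ∑-*ʳ xs (b r) T) (∑-*ʳ xs _ T)) ⟩
    length xs ^ 4 * (e * T)  ≡⟨ arr′ (length xs ^ 4) e T ⟩
    e * (length xs ^ 4 * T)  ∎
  cancel : ∀ m → e ≡ m → e ^ 3 ≤ length xs ^ 4 * T
  cancel zero    eq = subst (λ m → m ^ 3 ≤ length xs ^ 4 * T) (sym eq) z≤n
  cancel (suc m) eq = *-cancelˡ-≤ e ⦃ subst NonZero (sym eq) _ ⦄ e⁴≤

-- Embedding E⁺ over an edge

module _ {V : Set} (G : Graph V) where
  open Graph G

  join-apices : ∀ {k t} (f : ΘVertex k t → V) → (∀ {u v} → f u ≡ f v → u ≡ v) →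
    (∀ {u v} → Step k t u v → f u ~ f v) → ∀ {a b} → a ~ b →
    (∀ v → f v ≢ a) → (∀ v → f v ≢ b) →
    (∀ v → parity (position v) ≡ 0ℙ → a ~ f v) → (∀ v → parity (position v) ≡ 1ℙ → b ~ f v) →
    E⁺ k t ⊑ G
  join-apices {k} {t} f f-inj f-hom {a} {b} a~b f≢a f≢b even odd = g , (λ {u} {v} → inj u v) , λ {u} {v} → hom u v
    where
    g : WithApices (ΘVertex k t) → V
    g (old v) = f v
    g x⋆ = a
    g y⋆ = b
    inj : ∀ u v → g u ≡ g v → u ≡ v
    inj (old u) (old v) eq = cong old (f-inj eq)
    inj (old u) x⋆ eq = contradiction eq (f≢a u)
    inj (old u) y⋆ eq = contradiction eq (f≢b u)
    inj x⋆       (old v) eq = contradiction (sym eq) (f≢a v)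
    inj x⋆       x⋆ eq = refl
    inj x⋆       y⋆ eq = contradiction a~b (~-irrefl eq)
    inj y⋆       (old v) eq = contradiction (sym eq) (f≢b v)
    inj y⋆       x⋆ eq = contradiction a~b (~-irrefl (sym eq))
    inj y⋆       y⋆ eq = refl
    hom : ∀ u v → Graph._~_ (E⁺ k t) u v → g u ~ g v
    hom u v (inj₂ (inj₁ (refl , refl))) = a~b
    hom u v (inj₂ (inj₂ (refl , refl))) = ~-sym a~b
    hom (old u) (old v) (inj₁ (inj₁ s)) = f-hom s
    hom (old u) (old v) (inj₁ (inj₂ s)) = ~-sym (f-hom s)
    hom (old u) x⋆ (inj₁ e) = ~-sym (even u e)
    hom (old u) y⋆ (inj₁ e) = ~-sym (odd u e)
    hom x⋆ (old v) (inj₁ e) = even v e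
    hom y⋆ (old v) (inj₁ e) = odd v e

-- Allows induction on the position, back to the source. From the sink one goes back along the path
-- `zero`.
Θ-predecessor : ∀ {k t} (v : ΘVertex (2 + k) (suc t)) → v ≢ source → ∃ λ u → Step (2 + k) (suc t) u v
Θ-predecessor source            v≢ = contradiction refl v≢
Θ-predecessor {k} sink          v≢ = inner zero (Fin.fromℕ k) , last (cong (2 +_) (Fin.toℕ-fromℕ k))
Θ-predecessor (inner i zero)    v≢ = source , first refl
Θ-predecessor (inner i (suc j)) v≢ = inner i (Fin.inject₁ j) , next (cong suc (sym (Fin.toℕ-inject₁ j)))

alternate-even : ∀ m b → parity m ≡ 0ℙ → alternate m b ≡ b
alternate-even zero          b _ = refl
alternate-even (suc zero)    b ()
alternate-even (suc (suc m)) b e = trans (not-involutive _) (alternate-even m b e)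

alternate-odd : ∀ m b → parity m ≡ 1ℙ → alternate m b ≡ not b
alternate-odd zero          b ()
alternate-odd (suc zero)    b _ = refl
alternate-odd (suc (suc m)) b e = trans (not-involutive _) (alternate-odd m b e)

module _ {V : Set} {h : V → V → Bool} {k t : ℕ} (Θ : Θ-in h (2 + k) (suc t)) where
  open Θ-in Θ

  Θ-colour : ∀ (c : V → Bool) → (∀ {u v} → h u v ≡ true → c v ≡ not (c u)) →
             ∀ v → c (place v) ≡ alternate (position v) (c (place source))
  Θ-colour c proper v = go (position v) v refl
    where
    go : ∀ m v → position v ≡ m → c (place v) ≡ alternate m (c (place source))
    go zero    source eq = refl
    go (suc m) v      eq =
      let u , s = Θ-predecessor v (λ { refl → contradiction eq λ () }) in
      trans (proper (hom s)) (cong not (go m u (suc-injective (trans (sym (step-position s)) eq))))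

  Θ-vertex : ∀ (P : V → Set) → (∀ {u v} → h u v ≡ true → P u × P v) → ∀ v → P (place v)
  Θ-vertex P ends source      = proj₁ (ends (hom (first {i = zero} {j = zero} refl)))
  Θ-vertex P ends sink        = proj₂ (ends (hom (proj₂ (Θ-predecessor sink (λ ())))))
  Θ-vertex P ends (inner i j) = proj₂ (ends (hom (proj₂ (Θ-predecessor (inner i j) (λ ())))))

bool-cases : ∀ b c → b ≡ c ⊎ b ≡ not c
bool-cases true  true  = inj₁ refl
bool-cases true  false = inj₂ refl
bool-cases false true  = inj₂ refl
bool-cases false false = inj₁ refl

-- b is a bipartite subgraph of G; P and Q are sets of neighbours of the ends p, q of an edge.
module Neighbourhoods {V : Set} (_≟v_ : DecidableEquality V) (vs : List V) (uniq : Unique vs)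
  (G : Graph V) (b : V → V → Bool) (b-sym : ∀ u v → b u v ≡ b v u)
  (colour : V → Bool) (proper : ∀ {u v} → b u v ≡ true → colour v ≡ not (colour u))
  (b⇒~ : ∀ {u v} → b u v ≡ true → Graph._~_ G u v)
  {p q : V} (bpq : b p q ≡ true) (P Q : V → Bool)
  (P⇒b : ∀ {z} → P z ≡ true → b p z ≡ true) (Q⇒b : ∀ {z} → Q z ≡ true → b q z ≡ true)
  where

  open Graph G

  -- The ends `p` and `q` may themselves belong to `Q` and `P`; they are removed because they are to
  -- serve as the apices.
  inside : V → Bool
  inside z = (P z ∨ Q z) ∧ (not (does (z ≟v p)) ∧ not (does (z ≟v q)))

  host : V → V → Bool
  host z w = b z w ∧ (inside z ∧ inside w)

  host-sym : ∀ z w → host z w ≡ host w z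
  host-sym z w = cong₂ _∧_ (b-sym z w) (∧-comm (inside z) (inside w))

  host⇒b : ∀ {z w} → host z w ≡ true → b z w ≡ true
  host⇒b = proj₁ ∘ ∧-true

  -- Neighbours of `p` have the colour opposite to that of `p`, neighbours of `q` the same colour as
  -- `p`. So the colour decides which end is adjacent to `z`, without reference to `P` and `Q`.
  record Inside (z : V) : Set where
    field
      ≢p     : z ≢ p
      ≢q     : z ≢ q
      near-p : colour z ≡ not (colour p) → p ~ z
      near-q : colour z ≡ colour p → q ~ z

  inside-spec : ∀ {z} → inside z ≡ true → Inside z
  inside-spec {z} e with ∧-true {P z ∨ Q z} e
  ... | pq , ne with ∧-true {not (does (z ≟v p))} ne
  ...   | np , nq = record
    { ≢p = neq np ; ≢q = neq nq
    ; near-p = near-p ; near-q = near-q }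
    where
    neq : ∀ {w} → not (does (z ≟v w)) ≡ true → z ≢ w
    neq {w} e with z ≟v w
    ... | no z≢w = z≢w
    ∨-true : ∀ {a b} → a ∨ b ≡ true → a ≡ true ⊎ b ≡ true
    ∨-true {true}  _ = inj₁ refl
    ∨-true {false} e = inj₂ e
    near-p : colour z ≡ not (colour p) → p ~ z
    near-p cz with ∨-true {P z} pq
    ... | inj₁ Pz = b⇒~ (P⇒b Pz)
    ... | inj₂ Qz = contradiction
      (trans (sym (proper (Q⇒b Qz))) (trans cz (sym (proper bpq)))) (not-≢ (colour q))
    near-q : colour z ≡ colour p → q ~ z
    near-q cz with ∨-true {P z} pq
    ... | inj₁ Pz = contradiction (trans (sym (proper (P⇒b Pz))) cz) (not-≢ (colour p))
    ... | inj₂ Qz = b⇒~ (Q⇒b Qz)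

  -- Colours in the theta alternate with the position. If the source has the colour of `p`, then `q`
  -- is joined to the even positions and takes the role of the apex `x⋆`; otherwise `p` does.
  Θ⇒E⁺ : ∀ {k t} → 2 ≤ k → 1 ≤ t → Θ-in host k t → E⁺ k t ⊑ G
  Θ⇒E⁺ {suc (suc k)} {suc t} (s≤s (s≤s _)) (s≤s _) Θ =
    by-colour (bool-cases (colour (place source)) (colour p))
    where
    open Θ-in Θ
    colours : ∀ v → colour (place v) ≡ alternate (position v) (colour (place source))
    colours = Θ-colour Θ colour (proper ∘ host⇒b)
    spec : ∀ v → Inside (place v)
    spec = Θ-vertex Θ Inside λ {u} {v} e →
      let i , j = ∧-true (proj₂ (∧-true {b u v} e)) in inside-spec i , inside-spec j
    edges : ∀ {u v} → Step (2 + k) (suc t) u v → place u ~ place v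
    edges s = b⇒~ (host⇒b (hom s))
    even : ∀ {c} → colour (place source) ≡ c → ∀ v → parity (position v) ≡ 0ℙ → colour (place v) ≡ c
    even cs v e = trans (colours v) (trans (alternate-even (position v) _ e) cs)
    odd : ∀ {c} → colour (place source) ≡ c → ∀ v → parity (position v) ≡ 1ℙ → colour (place v) ≡ not c
    odd cs v e = trans (colours v) (trans (alternate-odd (position v) _ e) (cong not cs))
    by-colour : colour (place source) ≡ colour p ⊎ colour (place source) ≡ not (colour p) → E⁺ (2 + k) (suc t) ⊑ G
    by-colour (inj₁ cs) = join-apices G place injective edges (~-sym (b⇒~ bpq))
      (λ v → Inside.≢q (spec v)) (λ v → Inside.≢p (spec v))
      (λ v e → Inside.near-q (spec v) (even cs v e))
      (λ v e → Inside.near-p (spec v) (odd cs v e))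
    by-colour (inj₂ cs) = join-apices G place injective edges (b⇒~ bpq)
      (λ v → Inside.≢p (spec v)) (λ v → Inside.≢q (spec v))
      (λ v e → Inside.near-p (spec v) (even cs v e))
      (λ v e → Inside.near-q (spec v) (trans (odd cs v e) (not-involutive _)))

  b-irrefl : ∀ {u} → b u u ≢ true
  b-irrefl e = ~-irrefl refl (b⇒~ e)

  -- The edges of b from P to Q either lie in the host or contain p or q.
  edge-cases : ∀ z w → 𝟙 (P z) * (𝟙 (Q w) * 𝟙 (b w z)) ≤
    𝟙 (inside z) * (𝟙 (inside w) * 𝟙 (host z w)) +
    (𝟙 (does (z ≟v q)) * 𝟙 (Q w) + 𝟙 (does (w ≟v p)) * 𝟙 (P z))
  edge-cases z w = ≤-trans (≤-reflexive product) (𝟙-≤ λ e →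
    let Pz , e′ = ∧-true e
        Qw , bwz = ∧-true e′
    in cases Pz Qw (trans (b-sym z w) bwz) (z ≟v p) (z ≟v q) (w ≟v p) (w ≟v q))
    where
    product : 𝟙 (P z) * (𝟙 (Q w) * 𝟙 (b w z)) ≡ 𝟙 (P z ∧ (Q w ∧ b w z))
    product = sym (trans (𝟙-∧ (P z) _) (cong (𝟙 (P z) *_) (𝟙-∧ (Q w) _)))
    1≤* : ∀ {a c} → a ≡ true → c ≡ true → 1 ≤ 𝟙 a * 𝟙 c
    1≤* refl refl = ≤-refl
    inside-true : ∀ {v} → P v ∨ Q v ≡ true → v ≢ p → v ≢ q → inside v ≡ true
    inside-true {v} e v≢p v≢q = cong₂ _∧_ e
      (cong₂ _∧_ (cong not (dec-false (v ≟v p) v≢p)) (cong not (dec-false (v ≟v q) v≢q)))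
    ∨-left : ∀ {a c} → a ≡ true → a ∨ c ≡ true
    ∨-left refl = refl
    ∨-right : ∀ {a c} → c ≡ true → a ∨ c ≡ true
    ∨-right {true}  _ = refl
    ∨-right {false} e = e
    1≤** : ∀ {a c d} → a ≡ true → c ≡ true → d ≡ true → 1 ≤ 𝟙 a * (𝟙 c * 𝟙 (d ∧ (a ∧ c)))
    1≤** refl refl refl = ≤-refl
    cases : P z ≡ true → Q w ≡ true → b z w ≡ true →
      Dec (z ≡ p) → Dec (z ≡ q) → Dec (w ≡ p) → Dec (w ≡ q) →
      1 ≤ 𝟙 (inside z) * (𝟙 (inside w) * 𝟙 (host z w)) +
          (𝟙 (does (z ≟v q)) * 𝟙 (Q w) + 𝟙 (does (w ≟v p)) * 𝟙 (P z))
    cases Pz Qw bzw (yes refl) _ _ _ = contradiction (P⇒b Pz) b-irrefl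
    cases Pz Qw bzw (no _) _ _ (yes refl) = contradiction (Q⇒b Qw) b-irrefl
    cases Pz Qw bzw (no _) (yes z≡q) _ (no _) =
      ≤-trans (≤-trans (1≤* (dec-true (z ≟v q) z≡q) Qw) (m≤m+n _ (𝟙 (does (w ≟v p)) * 𝟙 (P z))))
              (m≤n+m _ (𝟙 (inside z) * (𝟙 (inside w) * 𝟙 (host z w))))
    cases Pz Qw bzw (no _) (no _) (yes w≡p) (no _) =
      ≤-trans (≤-trans (1≤* (dec-true (w ≟v p) w≡p) Pz) (m≤n+m _ (𝟙 (does (z ≟v q)) * 𝟙 (Q w))))
              (m≤n+m _ (𝟙 (inside z) * (𝟙 (inside w) * 𝟙 (host z w))))
    cases Pz Qw bzw (no z≢p) (no z≢q) (no w≢p) (no w≢q) =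
      ≤-trans (1≤** (inside-true (∨-left Pz) z≢p z≢q) (inside-true (∨-right {P w} Qw) w≢p w≢q) bzw) (m≤m+n _ _)

  -- The host has at most `2 * d` vertices and contains no theta; the remaining edges contain `p` or
  -- `q`, at most `d` of either kind.
  edges-between : ∀ {k t} → 2 ≤ k → 1 ≤ t → ¬ (E⁺ k t ⊑ G) → ∀ {d g} →
    (∑[ z ∈ vs ] 𝟙 (P z)) ≤ d → (∑[ w ∈ vs ] 𝟙 (Q w)) ≤ d → 1 ≤ g → 2 * d < g ^ k →
    (∑[ z ∈ vs ] ∑[ w ∈ vs ] (𝟙 (P z) * (𝟙 (Q w) * 𝟙 (b w z)))) ≤
    2 * (Θ-constant k t * (g + 3)) * (2 * d) + 2 * d
  edges-between {k} {t} 2≤k 1≤t free {d} {g} P≤ Q≤ 1≤g big = begin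
    _ ≤⟨ ∑-mono vs (λ z → ∑-mono vs λ w → edge-cases z w) ⟩
    (∑[ z ∈ vs ] ∑[ w ∈ vs ] (main z w + (at-q z w + at-p z w)))
      ≡⟨ trans (∑-cong vs λ z → ∑-+ vs (main z) _) (∑-+ vs _ _) ⟩
    (∑[ z ∈ vs ] ∑ vs (main z)) + (∑[ z ∈ vs ] ∑[ w ∈ vs ] (at-q z w + at-p z w))
      ≡⟨ cong ((∑[ z ∈ vs ] ∑ vs (main z)) +_) (trans (∑-cong vs λ z → ∑-+ vs (at-q z) (at-p z)) (∑-+ vs _ _)) ⟩
    (∑[ z ∈ vs ] ∑ vs (main z)) + ((∑[ z ∈ vs ] ∑ vs (at-q z)) + (∑[ z ∈ vs ] ∑ vs (at-p z)))
      ≤⟨ +-mono-≤ main-≤ (+-mono-≤ at-q-≤ at-p-≤) ⟩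
    2 * (Θ-constant k t * (g + 3)) * (2 * d) + (d + d)
      ≡⟨ cong (2 * (Θ-constant k t * (g + 3)) * (2 * d) +_) (cong (d +_) (sym (+-identityʳ d))) ⟩
    2 * (Θ-constant k t * (g + 3)) * (2 * d) + 2 * d ∎
    where
    open ≤-Reasoning
    main at-q at-p : V → V → ℕ
    main z w = 𝟙 (inside z) * (𝟙 (inside w) * 𝟙 (host z w))
    at-q z w = 𝟙 (does (z ≟v q)) * 𝟙 (Q w)
    at-p z w = 𝟙 (does (w ≟v p)) * 𝟙 (P z)
    one : ∀ {v m} → m ≤ d → (∑[ z ∈ vs ] 𝟙 (does (z ≟v v))) * m ≤ d
    one {v} {m} le = ≤-trans (*-monoˡ-≤ m (∑-≟-≤1 _≟v_ uniq v)) (≤-trans (≤-reflexive (*-identityˡ m)) le)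
    at-q-≤ : (∑[ z ∈ vs ] ∑ vs (at-q z)) ≤ d
    at-q-≤ = ≤-trans (≤-reflexive (sym (∑-*-∑ vs vs (λ z → 𝟙 (does (z ≟v q))) (λ w → 𝟙 (Q w))))) (one Q≤)
    at-p-≤ : (∑[ z ∈ vs ] ∑ vs (at-p z)) ≤ d
    at-p-≤ = ≤-trans (≤-reflexive (trans (∑-comm vs vs at-p)
      (sym (∑-*-∑ vs vs (λ w → 𝟙 (does (w ≟v p))) (λ z → 𝟙 (P z)))))) (one P≤)
    S : List V
    S = filter (λ z → inside z ≟ᵇ true) vs
    length-S : length S ≤ 2 * d
    length-S = begin
      length S                                       ≡⟨ length-filter≡∑ inside vs ⟩
      (∑[ z ∈ vs ] 𝟙 (inside z))                     ≤⟨ ∑-mono vs (λ z → split (P z) (Q z) _) ⟩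
      (∑[ z ∈ vs ] (𝟙 (P z) + 𝟙 (Q z)))              ≡⟨ ∑-+ vs _ _ ⟩
      (∑[ z ∈ vs ] 𝟙 (P z)) + (∑[ z ∈ vs ] 𝟙 (Q z))  ≤⟨ +-mono-≤ P≤ Q≤ ⟩
      d + d                                          ≡⟨ cong (d +_) (sym (+-identityʳ d)) ⟩
      2 * d                                          ∎
      where
      split : ∀ a c e → 𝟙 ((a ∨ c) ∧ e) ≤ 𝟙 a + 𝟙 c
      split true  c true  = s≤s z≤n
      split true  c false = z≤n
      split false true  e = 𝟙≤1 e
      split false false e = z≤n
    main-≤ : (∑[ z ∈ vs ] ∑ vs (main z)) ≤ 2 * (Θ-constant k t * (g + 3)) * (2 * d)
    main-≤ = begin
      (∑[ z ∈ vs ] ∑ vs (main z))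
        ≡⟨ ∑-cong vs (λ z → trans (∑-*ˡ vs (𝟙 (inside z)) (λ w → 𝟙 (inside w) * 𝟙 (host z w)))
                                  (cong (𝟙 (inside z) *_) (sym (∑-filter inside vs _)))) ⟩
      (∑[ z ∈ vs ] (𝟙 (inside z) * degree-in host S z))
        ≡⟨ ∑-filter inside vs _ ⟨
      ∑ S (degree-in host S)
        ≤⟨ Θ-free-bound _≟v_ host host-sym colour (proper ∘ host⇒b) (free ∘ Θ⇒E⁺ 2≤k 1≤t)
             (Unique.filter⁺ _ uniq) 1≤g (≤-<-trans length-S big) ⟩
      2 * (Θ-constant k t * (g + 3)) * length S
        ≤⟨ *-monoʳ-≤ (2 * (Θ-constant k t * (g + 3))) length-S ⟩
      2 * (Θ-constant k t * (g + 3)) * (2 * d) ∎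

-- Splitting vertices to bound the degrees

∑-concatMap : ∀ (g : B → List A) (xs : List B) (f : A → ℕ) →
              ∑ (concatMap g xs) f ≡ (∑[ x ∈ xs ] ∑ (g x) f)
∑-concatMap g []       f = refl
∑-concatMap g (x ∷ xs) f = trans (∑-++ (g x) (concatMap g xs) f) (cong (∑ (g x) f +_) (∑-concatMap g xs f))

module Split {V : Set} (_≟v_ : DecidableEquality V) (vs : List V) (uniq : Unique vs)
  (b : V → V → Bool) (b-sym : ∀ u v → b u v ≡ b v u) {d} (1≤d : 1 ≤ d)
  where

  module _ (u : V) where
    open Classes (classes _≟v_ (b u) 1≤d vs uniq) public

  edges : ℕ
  edges = ∑[ u ∈ vs ] ∑[ v ∈ vs ] 𝟙 (b u v)

  -- The i-th copy of u is joined to the neighbours of u with label i only.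
  copies : V → List (V × ℕ)
  copies u = map (u ,_) (upTo (suc (top u)))

  splits : List (V × ℕ)
  splits = concatMap copies vs

  ∑-splits : ∀ (f : V × ℕ → ℕ) → ∑ splits f ≡ (∑[ u ∈ vs ] ∑[ i ∈ upTo (suc (top u)) ] f (u , i))
  ∑-splits f = trans (∑-concatMap copies vs f) (∑-cong vs λ u → ∑-map (u ,_) (upTo (suc (top u))) f)

  -- Of the copies of `u`, at most one has the prescribed index `m u`.
  ∑-splits-≤ : ∀ (f m : V → ℕ) → (∑[ (u , i) ∈ splits ] (f u * 𝟙 (does (i ≟ m u)))) ≤ ∑ vs f
  ∑-splits-≤ f m = ≤-trans (≤-reflexive (∑-splits _)) (∑-mono vs λ u →
    ≤-trans (≤-reflexive (∑-*ˡ (upTo (suc (top u))) (f u) (λ i → 𝟙 (does (i ≟ m u)))))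
    (≤-trans (*-monoʳ-≤ (f u) (∑-≟-≤1 _≟_ (Unique.upTo⁺ (suc (top u))) (m u))) (≤-reflexive (*-identityʳ _))))

  ∑-splits-≡ : ∀ (f m : V → ℕ) → (∀ u → m u ≤ top u) →
               (∑[ (u , i) ∈ splits ] (f u * 𝟙 (does (i ≟ m u)))) ≡ ∑ vs f
  ∑-splits-≡ f m le = trans (∑-splits _) (∑-cong vs λ u →
    trans (∑-*ˡ (upTo (suc (top u))) (f u) (λ i → 𝟙 (does (i ≟ m u))))
    (trans (cong (f u *_) (∑-≟-≡ _≟_ (Unique.upTo⁺ (suc (top u))) (∈-upTo⁺ (s≤s (le u))))) (*-identityʳ _)))

  part : V × ℕ → V → Bool
  part (u , i) v = b u v ∧ does (i ≟ label u v)

  -- An edge `u v` survives between exactly one pair of copies, those numbered `label u v` and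
  -- `label v u`; thus the number of edges is preserved.
  joined : V × ℕ → V × ℕ → ℕ
  joined (u , i) (v , j) = 𝟙 (part (u , i) v) * 𝟙 (does (j ≟ label v u))

  ∑-joined : (∑[ p ∈ splits ] ∑[ q ∈ splits ] joined p q) ≡ edges
  ∑-joined = begin
    (∑[ p ∈ splits ] ∑[ q ∈ splits ] joined p q)
      ≡⟨ ∑-cong splits (λ p@(u , _) → ∑-splits-≡ (λ v → 𝟙 (part p v)) (λ v → label v u) (λ v → label≤top v u)) ⟩
    (∑[ p ∈ splits ] ∑[ v ∈ vs ] 𝟙 (part p v))
      ≡⟨ ∑-comm splits vs _ ⟩
    (∑[ v ∈ vs ] ∑[ p ∈ splits ] 𝟙 (part p v))
      ≡⟨ ∑-cong vs (λ v → trans (∑-cong splits λ (u , i) → 𝟙-∧ (b u v) _)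
                               (∑-splits-≡ (λ u → 𝟙 (b u v)) (λ u → label u v) (λ u → label≤top u v))) ⟩
    (∑[ v ∈ vs ] ∑[ u ∈ vs ] 𝟙 (b u v))
      ≡⟨ ∑-comm vs vs _ ⟩
    edges ∎
    where open ≡-Reasoning

  -- There are `suc (top u)` copies of `u`, and `top u * d` is at most the degree of `u`; summing,
  -- the tops add up to at most `length vs`.
  length-splits : edges ≤ length vs * d → length splits ≤ 2 * length vs
  length-splits le = begin
    length splits
      ≡⟨ trans (length≡∑ splits) (∑-splits _) ⟩
    (∑[ u ∈ vs ] ∑[ i ∈ upTo (suc (top u)) ] 1)
      ≡⟨ ∑-cong vs (λ u → trans (sym (length≡∑ (upTo (suc (top u))))) (length-upTo (suc (top u)))) ⟩
    (∑[ u ∈ vs ] suc (top u))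
      ≡⟨ trans (∑-+ vs (λ _ → 1) top) (cong (_+ ∑ vs top) (sym (length≡∑ vs))) ⟩
    length vs + ∑ vs top
      ≤⟨ +-monoʳ-≤ (length vs) (*-cancelʳ-≤ _ _ d ⦃ >-nonZero 1≤d ⦄ tops) ⟩
    length vs + length vs
      ≡⟨ cong (length vs +_) (sym (+-identityʳ _)) ⟩
    2 * length vs ∎
    where
    open ≤-Reasoning
    tops : ∑ vs top * d ≤ length vs * d
    tops = begin
      ∑ vs top * d                 ≡⟨ ∑-*ʳ vs top d ⟨
      (∑[ u ∈ vs ] (top u * d))    ≤⟨ ∑-mono vs (λ u → ≤-trans (m≤m+n _ _) (top*d≤ u)) ⟩
      edges                        ≤⟨ le ⟩
      length vs * d                ∎

  -- The four-cycles are counted in the split graph, but the bound for a single edge is taken in the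
  -- original one: the neighbours of a copy give a set `P` of at most `d` neighbours of the original
  -- vertex.
  cube-bound : edges ≤ length vs * d → ∀ {T} →
    (∀ {u v} → b u v ≡ true → ∀ (P Q : V → Bool) →
      (∀ {z} → P z ≡ true → b u z ≡ true) → (∀ {z} → Q z ≡ true → b v z ≡ true) →
      (∑[ z ∈ vs ] 𝟙 (P z)) ≤ d → (∑[ w ∈ vs ] 𝟙 (Q w)) ≤ d →
      (∑[ z ∈ vs ] ∑[ w ∈ vs ] (𝟙 (P z) * (𝟙 (Q w) * 𝟙 (b w z)))) ≤ T) →
    edges ^ 3 ≤ (2 * length vs) ^ 4 * T
  cube-bound le {T} local = begin
    edges ^ 3                                             ≡⟨ cong (_^ 3) ∑-joined ⟨
    (∑[ p ∈ splits ] ∑[ q ∈ splits ] joined p q) ^ 3      ≤⟨ cherries-C₄ splits joined T at-edge ⟩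
    length splits ^ 4 * T                                 ≤⟨ *-monoˡ-≤ T (^-monoˡ-≤ 4 (length-splits le)) ⟩
    (2 * length vs) ^ 4 * T                               ∎
    where
    open ≤-Reasoning
    cherry : V × ℕ → V × ℕ → V → V → ℕ
    cherry r p z w = 𝟙 (part r z) * (𝟙 (part p w) * 𝟙 (b w z))
    -- For fixed copies of `u` and `v`, a copy adjacent to one of them is determined by its
    -- underlying vertex, so the sum over copies collapses to a sum over vertices.
    cherries-≤ : ∀ {u i v j} →
      (∑[ s ∈ splits ] ∑[ q ∈ splits ] (joined (u , i) q * (joined s (v , j) * joined s q))) ≤
      (∑[ z ∈ vs ] ∑[ w ∈ vs ] cherry (u , i) (v , j) z w)
    cherries-≤ {u} {i} {v} {j} = begin
      (∑[ s ∈ splits ] ∑[ q ∈ splits ] (joined r q * (joined s p * joined s q)))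
        ≤⟨ ∑-mono splits (λ s → ∑-mono splits λ q → pointwise s q) ⟩
      (∑[ (w , j′) ∈ splits ] ∑[ (z , i′) ∈ splits ]
        ((cherry r p z w * 𝟙 (does (j′ ≟ label w v))) * 𝟙 (does (i′ ≟ label z u))))
        ≤⟨ ∑-mono splits (λ (w , j′) →
             ∑-splits-≤ (λ z → cherry r p z w * 𝟙 (does (j′ ≟ label w v))) (λ z → label z u)) ⟩
      (∑[ (w , j′) ∈ splits ] ∑[ z ∈ vs ] (cherry r p z w * 𝟙 (does (j′ ≟ label w v))))
        ≡⟨ ∑-cong splits (λ (w , j′) → ∑-*ʳ vs (λ z → cherry r p z w) (𝟙 (does (j′ ≟ label w v)))) ⟩
      (∑[ (w , j′) ∈ splits ] ((∑[ z ∈ vs ] cherry r p z w) * 𝟙 (does (j′ ≟ label w v))))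
        ≤⟨ ∑-splits-≤ (λ w → ∑[ z ∈ vs ] cherry r p z w) (λ w → label w v) ⟩
      (∑[ w ∈ vs ] ∑[ z ∈ vs ] cherry r p z w)
        ≡⟨ ∑-comm vs vs _ ⟩
      (∑[ z ∈ vs ] ∑[ w ∈ vs ] cherry r p z w) ∎
      where
      r = u , i
      p = v , j
      arr : ∀ P α B β γ c → (P * α) * ((B * β * γ) * c) ≡ ((P * ((B * γ) * c)) * β) * α
      arr = solve-∀
      pointwise : ∀ s q → joined r q * (joined s p * joined s q) ≤
        (cherry r p (proj₁ q) (proj₁ s) * 𝟙 (does (proj₂ s ≟ label (proj₁ s) v))) *
        𝟙 (does (proj₂ q ≟ label (proj₁ q) u))
      pointwise (w , j′) (z , i′) = begin
        (𝟙 (part r z) * α) * ((𝟙 (b w v ∧ does (j′ ≟ label w v)) * γ) * joined (w , j′) (z , i′))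
          ≤⟨ *-monoʳ-≤ (𝟙 (part r z) * α) (*-mono-≤
               (≤-reflexive (cong (_* γ) (𝟙-∧ (b w v) _))) bwz) ⟩
        (𝟙 (part r z) * α) * ((𝟙 (b w v) * β * γ) * 𝟙 (b w z))
          ≡⟨ arr (𝟙 (part r z)) α (𝟙 (b w v)) β γ (𝟙 (b w z)) ⟩
        ((𝟙 (part r z) * ((𝟙 (b w v) * γ) * 𝟙 (b w z))) * β) * α
          ≡⟨ cong (λ m → ((𝟙 (part r z) * (m * 𝟙 (b w z))) * β) * α)
               (trans (cong (λ c → 𝟙 c * γ) (b-sym w v)) (sym (𝟙-∧ (b v w) _))) ⟩
        (cherry r p z w * β) * α ∎
        where
        α = 𝟙 (does (i′ ≟ label z u))
        β = 𝟙 (does (j′ ≟ label w v))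
        γ = 𝟙 (does (j ≟ label v w))
        bwz : joined (w , j′) (z , i′) ≤ 𝟙 (b w z)
        bwz = begin
          𝟙 (b w z ∧ does (j′ ≟ label w z)) * 𝟙 (does (i′ ≟ label z w))
            ≤⟨ *-mono-≤ (≤-reflexive (𝟙-∧ (b w z) _)) (𝟙≤1 (does (i′ ≟ label z w))) ⟩
          𝟙 (b w z) * 𝟙 (does (j′ ≟ label w z)) * 1
            ≡⟨ *-identityʳ _ ⟩
          𝟙 (b w z) * 𝟙 (does (j′ ≟ label w z))
            ≤⟨ *-monoʳ-≤ (𝟙 (b w z)) (𝟙≤1 (does (j′ ≟ label w z))) ⟩
          𝟙 (b w z) * 1
            ≡⟨ *-identityʳ _ ⟩
          𝟙 (b w z) ∎
    at-edge : ∀ r p → joined r p * (∑[ s ∈ splits ] ∑[ q ∈ splits ] (joined r q * (joined s p * joined s q))) ≤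
              joined r p * T
    at-edge (u , i) (v , j) = by-cases (b u v) refl
      where
      c₄ = ∑[ s ∈ splits ] ∑[ q ∈ splits ] (joined (u , i) q * (joined s (v , j) * joined s q))
      by-cases : ∀ c → b u v ≡ c → joined (u , i) (v , j) * c₄ ≤ joined (u , i) (v , j) * T
      by-cases true  e = *-monoʳ-≤ (joined (u , i) (v , j)) (≤-trans (cherries-≤ {u} {i} {v} {j})
        (local e (part (u , i)) (part (v , j))
          (λ {z} → proj₁ ∘ ∧-true {b u z}) (λ {z} → proj₁ ∘ ∧-true {b v z}) (class≤d u i) (class≤d v j)))
      by-cases false e = ≤-trans (≤-reflexive (cong (_* c₄) none)) z≤n
        where
        none : joined (u , i) (v , j) ≡ 0
        none = cong (λ c → 𝟙 (c ∧ does (i ≟ label u v)) * 𝟙 (does (j ≟ label v u))) e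

-- The exponent

^-distribʳ-* : ∀ m n k → (m * n) ^ k ≡ m ^ k * n ^ k
^-distribʳ-* m n zero    = refl
^-distribʳ-* m n (suc k) = trans (cong ((m * n) *_) (^-distribʳ-* m n k)) (arr m n (m ^ k) (n ^ k))
  where
  arr : ∀ m n a b → (m * n) * (a * b) ≡ (m * a) * (n * b)
  arr = solve-∀

-- Induction on `m`: when `m` grows by one, the rounded-down root grows by at most one.
integer-root : ∀ k .⦃ _ : NonZero k ⦄ m → 1 ≤ m → ∃ λ g → 1 ≤ g × g ^ k ≤ m × m < suc g ^ k
integer-root k@(suc j) (suc zero) _ = 1 , ≤-refl , ≤-reflexive (^-zeroˡ k) ,
  *-mono-≤ {2} ≤-refl (m^n>0 2 j)
integer-root k (suc m@(suc _)) _ with integer-root k m (s≤s z≤n)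
... | g , 1≤g , lower , upper with suc m <? suc g ^ k
...   | yes lt = g , 1≤g , ≤-trans lower (n≤1+n m) , lt
...   | no ≮   = suc g , s≤s z≤n , ≮⇒≥ ≮ , ≤-<-trans upper (^-monoˡ-< k (n<1+n (suc g)))

-- The cube bound is raised to the power `k`, where `root` turns `g ^ k * d ^ k` into a multiple of
-- `d ^ suc k`. A factor `n ^ suc k` makes this a power of `d * n`, hence of `e`, and
-- `e ^ suc k * n ^ suc k` cancels. The equations for `a` and `m` express 2k - 1 and 3k - 1 without
-- truncated subtraction.
exponent-arithmetic : ∀ {k a m e n c g d} → 1 ≤ e → 1 ≤ n →
  a + suc k ≡ 3 * k → m + suc k ≡ 4 * k →
  e ^ 3 ≤ (2 * n) ^ 4 * (c * (g * d)) → g ^ k ≤ 2 * d → d * n ≤ 2 * e →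
  e ^ a ≤ (2 * (2 ^ (4 * k) * c ^ k) * 2 ^ suc k) * n ^ m
exponent-arithmetic {k} {a} {m} {e} {n} {c} {g} {d} 1≤e 1≤n a+ m+ cube root density =
  *-cancelʳ-≤ _ _ (e ^ suc k * n ^ suc k)
    ⦃ m*n≢0 (e ^ suc k) (n ^ suc k) ⦃ m^n≢0 e (suc k) ⦄ ⦃ m^n≢0 n (suc k) ⦄ ⦄ (begin
    e ^ a * (e ^ suc k * n ^ suc k)
      ≡⟨ *-assoc (e ^ a) _ _ ⟨
    (e ^ a * e ^ suc k) * n ^ suc k
      ≡⟨ cong (_* n ^ suc k) (trans (sym (^-distribˡ-+-* e a (suc k))) (trans (cong (e ^_) a+) (sym (^-*-assoc e 3 k)))) ⟩
    (e ^ 3) ^ k * n ^ suc k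
      ≤⟨ *-monoˡ-≤ (n ^ suc k) (^-monoˡ-≤ k cube) ⟩
    ((2 * n) ^ 4 * (c * (g * d))) ^ k * n ^ suc k
      ≡⟨ cong (_* n ^ suc k) expand ⟩
    ((2 ^ (4 * k) * n ^ (4 * k)) * (c ^ k * (g ^ k * d ^ k))) * n ^ suc k
      ≤⟨ *-monoˡ-≤ (n ^ suc k) (*-monoʳ-≤ (2 ^ (4 * k) * n ^ (4 * k)) (*-monoʳ-≤ (c ^ k) (*-monoˡ-≤ (d ^ k) root))) ⟩
    ((2 ^ (4 * k) * n ^ (4 * k)) * (c ^ k * ((2 * d) * d ^ k))) * n ^ suc k
      ≡⟨ arr (2 ^ (4 * k)) (n ^ (4 * k)) (c ^ k) d (d ^ k) (n ^ suc k) ⟩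
    (2 * (2 ^ (4 * k) * c ^ k) * n ^ (4 * k)) * (d ^ suc k * n ^ suc k)
      ≡⟨ cong (2 * (2 ^ (4 * k) * c ^ k) * n ^ (4 * k) *_) (^-distribʳ-* d n (suc k)) ⟨
    (2 * (2 ^ (4 * k) * c ^ k) * n ^ (4 * k)) * (d * n) ^ suc k
      ≤⟨ *-monoʳ-≤ (2 * (2 ^ (4 * k) * c ^ k) * n ^ (4 * k)) (^-monoˡ-≤ (suc k) density) ⟩
    (2 * (2 ^ (4 * k) * c ^ k) * n ^ (4 * k)) * (2 * e) ^ suc k
      ≡⟨ cong₂ (λ u v → 2 * (2 ^ (4 * k) * c ^ k) * u * v)
           (trans (cong (n ^_) (sym m+)) (^-distribˡ-+-* n m (suc k))) (^-distribʳ-* 2 e (suc k)) ⟩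
    (2 * (2 ^ (4 * k) * c ^ k) * (n ^ m * n ^ suc k)) * (2 ^ suc k * e ^ suc k)
      ≡⟨ arr′ (2 * (2 ^ (4 * k) * c ^ k)) (n ^ m) (n ^ suc k) (2 ^ suc k) (e ^ suc k) ⟩
    (2 * (2 ^ (4 * k) * c ^ k) * 2 ^ suc k) * n ^ m * (e ^ suc k * n ^ suc k) ∎)
  where
  open ≤-Reasoning
  instance
    e≢0 = >-nonZero 1≤e
    n≢0 = >-nonZero 1≤n
  expand : ((2 * n) ^ 4 * (c * (g * d))) ^ k ≡ (2 ^ (4 * k) * n ^ (4 * k)) * (c ^ k * (g ^ k * d ^ k))
  expand = trans (^-distribʳ-* ((2 * n) ^ 4) (c * (g * d)) k) (cong₂ _*_
    (trans (^-*-assoc (2 * n) 4 k) (^-distribʳ-* 2 n (4 * k)))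
    (trans (^-distribʳ-* c (g * d) k) (cong (c ^ k *_) (^-distribʳ-* g d k))))
  arr : ∀ A N C d D M → ((A * N) * (C * ((2 * d) * D))) * M ≡ (2 * (A * C) * N) * ((d * D) * M)
  arr = solve-∀
  arr′ : ∀ A M N B E → (A * (M * N)) * (B * E) ≡ (A * B) * M * (E * N)
  arr′ = solve-∀

-- The edge bound for graphs without `E⁺`, and the extremal number.

∑-cartesianProduct : ∀ (xs : List A) (ys : List B) (f : A × B → ℕ) →
  ∑ (cartesianProduct xs ys) f ≡ (∑[ x ∈ xs ] ∑[ y ∈ ys ] f (x , y))
∑-cartesianProduct []       ys f = refl
∑-cartesianProduct (x ∷ xs) ys f = trans (∑-++ (map (x ,_) ys) (cartesianProduct xs ys) f)
  (cong₂ _+_ (∑-map (x ,_) ys f) (∑-cartesianProduct xs ys f))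

length-filter-≤ : ∀ {P Q : A → Set} (P? : U.Decidable P) (Q? : U.Decidable Q) → (∀ {x} → P x → Q x) →
  ∀ xs → length (filter P? xs) ≤ (∑[ x ∈ xs ] 𝟙 (does (Q? x)))
length-filter-≤ P? Q? P⇒Q []       = z≤n
length-filter-≤ P? Q? P⇒Q (x ∷ xs) with P? x
... | no _   = ≤-trans (length-filter-≤ P? Q? P⇒Q xs) (m≤n+m _ (𝟙 (does (Q? x))))
... | yes Px = +-mono-≤ (≤-reflexive (cong 𝟙 (sym (dec-true (Q? x) (P⇒Q Px))))) (length-filter-≤ P? Q? P⇒Q xs)

module _ {n : ℕ} (G : Graph (Fin n)) where
  open Graph G

  adjacent : Fin n → Fin n → Bool
  adjacent u v = does (u ~? v)

  adjacent-sym : ∀ u v → adjacent u v ≡ adjacent v u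
  adjacent-sym u v with v ~? u
  ... | yes e = dec-true (u ~? v) (~-sym e)
  ... | no ¬e = dec-false (u ~? v) (¬e ∘ ~-sym)

  edgeCount-≤ : edgeCount G ≤ (∑[ u ∈ allFin n ] ∑[ v ∈ allFin n ] 𝟙 (adjacent u v))
  edgeCount-≤ = ≤-trans
    (length-filter-≤ _ (λ (u , v) → u ~? v) proj₂ (cartesianProduct (allFin n) (allFin n)))
    (≤-reflexive (∑-cartesianProduct (allFin n) (allFin n) _))

  module _ {k t : ℕ} (2≤k : 2 ≤ k) (1≤t : 1 ≤ t) (free : ¬ (E⁺ k t ⊑ G)) (1≤n : 1 ≤ n) where

    private
      vs : List (Fin n)
      vs = allFin n
      uniq : Unique vs
      uniq = Unique.allFin⁺ n
      length-vs : length vs ≡ n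
      length-vs = length-tabulate id
      cut : ∃ λ (c : Fin n → Bool) → _
      cut = half-cut Fin._≟_ (λ u v → 𝟙 (adjacent u v)) (λ u v → cong 𝟙 (adjacent-sym u v))
              (λ u → cong 𝟙 (dec-false (u ~? u) (~-irrefl refl))) vs uniq
      c₀ : ℕ
      c₀ = Θ-constant k t

    colour : Fin n → Bool
    colour = proj₁ cut

    b : Fin n → Fin n → Bool
    b u v = adjacent u v ∧ (colour u xor colour v)

    b-sym : ∀ u v → b u v ≡ b v u
    b-sym u v = cong₂ _∧_ (adjacent-sym u v) (xor-comm (colour u) (colour v))

    b⇒~ : ∀ {u v} → b u v ≡ true → u ~ v
    b⇒~ {u} {v} e = does-true (u ~? v) (proj₁ (∧-true e))

    proper : ∀ {u v} → b u v ≡ true → colour v ≡ not (colour u)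
    proper {u} {v} e = xor-true (colour u) (colour v) (proj₂ (∧-true {adjacent u v} e))
      where
      xor-true : ∀ c c′ → (c xor c′) ≡ true → c′ ≡ not c
      xor-true true  false _ = refl
      xor-true false true  _ = refl

    -- Ordered pairs: every edge of the cut counts twice.
    e : ℕ
    e = ∑[ u ∈ vs ] ∑[ v ∈ vs ] 𝟙 (b u v)

    edgeCount-≤-2e : edgeCount G ≤ 2 * e
    edgeCount-≤-2e = ≤-trans edgeCount-≤ (≤-trans (proj₂ cut) (≤-reflexive
      (cong (2 *_) (∑-cong vs λ u → ∑-cong vs λ v → sym (𝟙-∧ (adjacent u v) _)))))

    -- `edges-between` is used with `suc g`, whose `k`-th power exceeds `2 * d`; as `1 ≤ g`, the
    -- terms without `g` fit into the constant.
    cubic : ∀ {d g} → 1 ≤ d → e ≤ n * d → 1 ≤ g → 2 * d < suc g ^ k →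
            e ^ 3 ≤ (2 * n) ^ 4 * ((20 * c₀ + 2) * (g * d))
    cubic {d} {g} 1≤d e≤ 1≤g root = subst (λ m → e ^ 3 ≤ (2 * m) ^ 4 * ((20 * c₀ + 2) * (g * d))) length-vs
      (Split.cube-bound Fin._≟_ vs uniq b b-sym 1≤d (≤-trans e≤ (≤-reflexive (cong (_* d) (sym length-vs))))
        λ buv P Q P⇒b Q⇒b P≤ Q≤ → ≤-trans
          (Neighbourhoods.edges-between Fin._≟_ vs uniq G b b-sym colour proper b⇒~ buv P Q P⇒b Q⇒b
             2≤k 1≤t free P≤ Q≤ (s≤s z≤n) root)
          (begin
            2 * (c₀ * (suc g + 3)) * (2 * d) + 2 * d
              ≡⟨ arr c₀ g d ⟩
            4 * c₀ * d * g + (16 * c₀ + 2) * d * 1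
              ≤⟨ +-monoʳ-≤ (4 * c₀ * d * g) (*-monoʳ-≤ ((16 * c₀ + 2) * d) 1≤g) ⟩
            4 * c₀ * d * g + (16 * c₀ + 2) * d * g
              ≡⟨ arr′ c₀ g d ⟩
            (20 * c₀ + 2) * (g * d) ∎))
      where
      open ≤-Reasoning
      arr : ∀ c g d → 2 * (c * ((1 + g) + 3)) * (2 * d) + 2 * d ≡ 4 * c * d * g + (16 * c + 2) * d * 1
      arr = solve-∀
      arr′ : ∀ c g d → 4 * c * d * g + (16 * c + 2) * d * g ≡ (20 * c + 2) * (g * d)
      arr′ = solve-∀

    dense-bound : n ≤ e →
      e ^ (2 * k ∸ 1) ≤ (2 * (2 ^ (4 * k) * (20 * c₀ + 2) ^ k) * 2 ^ suc k) * n ^ (3 * k ∸ 1)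
    dense-bound n≤e =
      let g , 1≤g , lower , upper = integer-root k (2 * d) (s≤s z≤n)
      in exponent-arithmetic {k} {g = g} {d = d} (≤-trans 1≤n n≤e) 1≤n
           (trans (arr (2 * k ∸ 1) k) (trans (cong (_+ k) (m∸n+n≡m 1≤2k)) (arr′ k)))
           (trans (arr (3 * k ∸ 1) k) (trans (cong (_+ k) (m∸n+n≡m 1≤3k)) (arr″ k)))
           (cubic (s≤s z≤n) e≤nd 1≤g upper) lower dn≤2e
      where
      instance
        k≢0 : NonZero k
        k≢0 = >-nonZero (≤-trans (s≤s z≤n) 2≤k)
        n≢0 : NonZero n
        n≢0 = >-nonZero 1≤n
      d : ℕ
      -- Rounding up gives `e ≤ n * d`, and because of `n ≤ e` it costs at most a factor 2 in
      -- `d * n ≤ 2 * e`.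
      d = suc (e / n)
      1≤2k : 1 ≤ 2 * k
      1≤2k = ≤-trans (≤-trans (s≤s z≤n) 2≤k) (m≤m+n k _)
      1≤3k : 1 ≤ 3 * k
      1≤3k = ≤-trans (≤-trans (s≤s z≤n) 2≤k) (m≤m+n k _)
      arr : ∀ a k → a + (1 + k) ≡ (a + 1) + k
      arr = solve-∀
      arr′ : ∀ k → 2 * k + k ≡ 3 * k
      arr′ = solve-∀
      arr″ : ∀ k → 3 * k + k ≡ 4 * k
      arr″ = solve-∀
      e≤nd : e ≤ n * d
      e≤nd = begin
        e                    ≡⟨ m≡m%n+[m/n]*n e n ⟩
        e % n + (e / n) * n  ≤⟨ +-monoˡ-≤ _ (<⇒≤ (m%n<n e n)) ⟩
        d * n                ≡⟨ *-comm d n ⟩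
        n * d                ∎
        where open ≤-Reasoning
      dn≤2e : d * n ≤ 2 * e
      dn≤2e = +-mono-≤ n≤e (≤-trans (m/n*n≤m e n) (m≤m+n e 0))

edges-bound : ∀ {k t} → 2 ≤ k → 1 ≤ t → ∃ λ C → ∀ {n} → 1 ≤ n → ∀ (G : Graph (Fin n)) → ¬ (E⁺ k t ⊑ G) →
  edgeCount G ^ (2 * k ∸ 1) ≤ C * n ^ (3 * k ∸ 1)
edges-bound {k} {t} 2≤k 1≤t = 2 ^ (2 * k ∸ 1) * suc C , bound
  where
  open ≤-Reasoning
  C : ℕ
  C = 2 * (2 ^ (4 * k) * (20 * Θ-constant k t + 2) ^ k) * 2 ^ suc k
  bound : ∀ {n} → 1 ≤ n → ∀ (G : Graph (Fin n)) → ¬ (E⁺ k t ⊑ G) →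
    edgeCount G ^ (2 * k ∸ 1) ≤ (2 ^ (2 * k ∸ 1) * suc C) * n ^ (3 * k ∸ 1)
  bound {n} 1≤n G free = begin
    edgeCount G ^ (2 * k ∸ 1)                      ≤⟨ ^-monoˡ-≤ (2 * k ∸ 1) (edgeCount-≤-2e G 2≤k 1≤t free 1≤n) ⟩
    (2 * e₀) ^ (2 * k ∸ 1)                         ≡⟨ ^-distribʳ-* 2 e₀ (2 * k ∸ 1) ⟩
    2 ^ (2 * k ∸ 1) * e₀ ^ (2 * k ∸ 1)             ≤⟨ *-monoʳ-≤ (2 ^ (2 * k ∸ 1)) (cases (≤-total e₀ n)) ⟩
    2 ^ (2 * k ∸ 1) * (suc C * n ^ (3 * k ∸ 1))    ≡⟨ *-assoc (2 ^ (2 * k ∸ 1)) _ _ ⟨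
    (2 ^ (2 * k ∸ 1) * suc C) * n ^ (3 * k ∸ 1)    ∎
    where
    e₀ : ℕ
    e₀ = e G 2≤k 1≤t free 1≤n
    cases : e₀ ≤ n ⊎ n ≤ e₀ → e₀ ^ (2 * k ∸ 1) ≤ suc C * n ^ (3 * k ∸ 1)
    -- The additional 1 in `suc C` pays for this case, where comparing the exponents of `n` is
    -- enough.
    cases (inj₁ sparse) = begin
      e₀ ^ (2 * k ∸ 1)       ≤⟨ ^-monoˡ-≤ (2 * k ∸ 1) sparse ⟩
      n ^ (2 * k ∸ 1)        ≤⟨ ^-monoʳ-≤ n ⦃ >-nonZero 1≤n ⦄ (∸-monoˡ-≤ 1 (*-monoˡ-≤ k (s≤s (s≤s (z≤n {1}))))) ⟩
      n ^ (3 * k ∸ 1)        ≤⟨ m≤m+n _ (C * n ^ (3 * k ∸ 1)) ⟩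
      suc C * n ^ (3 * k ∸ 1) ∎
    cases (inj₂ dense) = ≤-trans (dense-bound G 2≤k 1≤t free 1≤n dense) (m≤n+m _ (n ^ (3 * k ∸ 1)))

proposition3p1 : ∀ (k t : ℕ) → 2 ≤ k → 2 ≤ t →
    (λ n → ex n (E⁺ k t)) =O[n^ 3 * k ∸ 1 / 2 * k ∸ 1 ]
proposition3p1 k t 2≤k 2≤t =
  let C , bound = edges-bound {k} {t} 2≤k (≤-trans (s≤s z≤n) 2≤t) in
  C , 1 , λ n 1≤n →
    let open IsExtremalNumber (ex-isExtremalNumber n (E⁺ k t))
        G , free , count = attained
    in subst (λ m → m ^ (2 * k ∸ 1) ≤ C * n ^ (3 * k ∸ 1)) count (bound 1≤n G free)
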